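{- Let $h\colon[n]\to[n]$ be a Hessenberg function and let $w\in\mathfrak S_n$ be any permutation. The graph $\Gamma_{w,h}$ is regular if and only if $w$ avoids all of the associated patterns $[2143]_h$, $[1324]_h$, $[1243]_h$, $[2134]_h$, $[1423]_h$, $[2314]_h$, $[25314]_h$, $[24315]_h$, $[14325]_h$, and $[15324]_h$.
   Context: A Hessenberg function is a nondecreasing $h\colon[n]\to[n]$ with $h(i)\ge i$. For $u\in\mathfrak S_n$ (one-line notation) and $i<j$, $u(i,j)$ is obtained from $u$ by swapping the entries in positions $i$ and $j$. The Bruhat order $\preceq$ is the reflexive–transitive closure of $u\prec u(i,j)$ when $u(i,j)$ has more inversions than $u$; $w_0=n(n-1)\cdots1$, $[v,w_0]=\{u\mid v\preceq u\preceq w_0\}$. A generator for $h$ is a $w$ with $w^{ -1}(w(i)+1)\le h(i)$ whenever $w(i)\le n-1$. For each $w\in\mathfrak S_n$ there is a unique generator $\widetilde w$ (the corresponding generator) such that for all $i<j$ with $j\le h(i)$: $\widetilde w(i)<\widetilde w(j)$ iff $w(i)<w(j)$. $\Gamma_h$ is the graph with vertex set $\mathfrak S_n$ and edges $\{u,u(i,j)\}$ for $1\le i<j\le h(i)$; $\Gamma_{w,h}$ is the subgraph of $\Gamma_h$ induced on the vertex set $\{w\widetilde w^{ -1}u\mid u\in[\widetilde w,w_0]\}$ (product = composition of permutations; this is the set of torus fixed points of the Hessenberg Schubert variety $\Omega_{w,h}$, and equals $[w,w_0]$ when $w$ is a generator). A graph is regular if all vertices have the same degree. Associated patterns: $w$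 contains $[2143]_h$ if $w(j)<w(i)<w(\ell)<w(k)$ for some $i<j<k<\ell\le h(i)$; $[1324]_h$ if $w(i)<w(k)<w(j)<w(\ell)$ for some $i<j<k<\ell\le h(j)$ with $k\le h(i)$; $[1243]_h$ if $w(i)<w(j)<w(\ell)<w(k)$ for some $i<j<k<\ell\le h(j)$ with $j\le h(i)<\ell$; $[2134]_h$ if $w(j)<w(i)<w(k)<w(\ell)$ for some $i<j<k<\ell\le h(k)$ with $k\le h(i)<\ell$; $[1423]_h$ if $w(i)<w(k)<w(\ell)<w(j)$ for some $i<j<k<\ell\le h(j)$ with $k\le h(i)<\ell$; $[2314]_h$ if $w(k)<w(i)<w(j)<w(\ell)$ for some $i<j<k<\ell\le h(j)$ with $k\le h(i)<\ell$. Further, for some $i<j<k\le h(i)<\ell\le h(j)<m\le h(k)$: $w$ contains $[25314]_h$ if $w(\ell)<w(i)<w(k)<w(m)<w(j)$; $[24315]_h$ if $w(\ell)<w(i)<w(k)<w(j)<w(m)$; $[14325]_h$ if $w(i)<w(\ell)<w(k)<w(j)<w(m)$; $[15324]_h$ if $w(i)<w(\ell)<w(k)<w(m)<w(j)$. -}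

module Defs where

open import Data.Nat as ℕ using (ℕ; suc)
open import Data.Fin using (Fin; toℕ; fromℕ<; opposite; _<_; _≤_)
open import Data.Fin.Properties using (_<?_)
open import Data.Fin.Permutation using (Permutation′; _⟨$⟩ʳ_; _⟨$⟩ˡ_)
open import Data.Fin.Permutation.Components using (transpose)
open import Data.List using (List; length; filter; cartesianProduct; allFin)
open import Data.List.Relation.Unary.Any using (Any)
open import Data.List.Relation.Unary.AllPairs using (AllPairs)
open import Data.Product using (Σ; ∃; ∃-syntax; _×_; _,_; proj₁; proj₂)
open import Function using (_∘_; _⇔_)
open import Relation.Binary.PropositionalEquality using (_≡_; _≗_)
open import Relation.Nullary using (¬_)
open import Relation.Nullary.Decidable using (_×-dec_)

-- Positions and values are 0-based: [n] is represented by Fin n.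
-- A permutation in one-line notation is a function Fin n → Fin n
-- (for w and w̃ we use the stdlib bundle Permutation′ n, which carries the inverse).

OneLine : ℕ → Set
OneLine n = Fin n → Fin n

record Hessenberg (n : ℕ) : Set where
  field
    fun      : Fin n → Fin n
    monotone : ∀ {i j} → i ≤ j → fun i ≤ fun j
    extensive : ∀ i → i ≤ fun i
open Hessenberg public

swapPos : ∀ {n} → OneLine n → Fin n → Fin n → OneLine n
swapPos u i j = u ∘ transpose i j

inv : ∀ {n} → OneLine n → ℕ
inv {n} u = length (filter (λ p → (proj₁ p <? proj₂ p) ×-dec (u (proj₂ p) <? u (proj₁ p)))
                           (cartesianProduct (allFin n) (allFin n)))

BruhatStep : ∀ {n} → OneLine n → OneLine n → Set
BruhatStep {n} u v = ∃[ i ] ∃[ j ] (i < j × v ≗ swapPos u i j × inv u ℕ.< inv v)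

data _≼_ {n : ℕ} : OneLine n → OneLine n → Set where
  ≼-refl : ∀ {u v} → u ≗ v → u ≼ v
  ≼-step : ∀ {u v x} → BruhatStep u v → v ≼ x → u ≼ x

w₀ : ∀ {n} → OneLine n
w₀ = opposite

InInterval : ∀ {n} → OneLine n → OneLine n → Set
InInterval v u = v ≼ u × u ≼ w₀

-- generator for h: w⁻¹(w(i)+1) ≤ h(i) whenever w(i) ≤ n-1 (1-based), i.e. w(i)+1 exists
IsGenerator : ∀ {n} → Hessenberg n → Permutation′ n → Set
IsGenerator {n} h w = ∀ i → (p : suc (toℕ (w ⟨$⟩ʳ i)) ℕ.< n) →
  w ⟨$⟩ˡ fromℕ< p ≤ fun h i

IsCorrespondingGenerator : ∀ {n} → Hessenberg n → Permutation′ n → Permutation′ n → Set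
IsCorrespondingGenerator h w g =
  IsGenerator h g ×
  (∀ i j → i < j → j ≤ fun h i → ((g ⟨$⟩ʳ i < g ⟨$⟩ʳ j) ⇔ (w ⟨$⟩ʳ i < w ⟨$⟩ʳ j)))

Adjacent : ∀ {n} → Hessenberg n → OneLine n → OneLine n → Set
Adjacent h u v = ∃[ i ] ∃[ j ] (i < j × j ≤ fun h i × v ≗ swapPos u i j)

VertexΓ : ∀ {n} → Permutation′ n → Permutation′ n → OneLine n → Set
VertexΓ w g v = ∃[ u ] (InInterval (g ⟨$⟩ʳ_) u × v ≗ (λ k → w ⟨$⟩ʳ (g ⟨$⟩ˡ u k)))

HasCardinality : ∀ {n} → (OneLine n → Set) → ℕ → Set
HasCardinality {n} P d = Σ (List (OneLine n)) λ L →
  length L ≡ d × AllPairs (λ a b → ¬ (a ≗ b)) L × (∀ x → P x ⇔ Any (x ≗_) L)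

HasDegree : ∀ {n} → Hessenberg n → Permutation′ n → Permutation′ n → OneLine n → ℕ → Set
HasDegree h w g v d = HasCardinality (λ x → VertexΓ w g x × Adjacent h v x) d

IsRegularΓ : ∀ {n} → Hessenberg n → Permutation′ n → Permutation′ n → Set
IsRegularΓ h w g = ∃[ d ] (∀ v → VertexΓ w g v → HasDegree h w g v d)

module _ {n : ℕ} (h : Hessenberg n) (w : Permutation′ n) where
  private
    H = fun h
    W = w ⟨$⟩ʳ_

  Contains2143 Contains1324 Contains1243 Contains2134 Contains1423 Contains2314 : Set
  Contains2143 = ∃[ i ] ∃[ j ] ∃[ k ] ∃[ l ] (i < j × j < k × k < l × l ≤ H i ×
    W j < W i × W i < W l × W l < W k)
  Contains1324 = ∃[ i ] ∃[ j ] ∃[ k ] ∃[ l ] (i < j × j < k × k < l × l ≤ H j × k ≤ H i ×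
    W i < W k × W k < W j × W j < W l)
  Contains1243 = ∃[ i ] ∃[ j ] ∃[ k ] ∃[ l ] (i < j × j < k × k < l × l ≤ H j × j ≤ H i × H i < l ×
    W i < W j × W j < W l × W l < W k)
  Contains2134 = ∃[ i ] ∃[ j ] ∃[ k ] ∃[ l ] (i < j × j < k × k < l × l ≤ H k × k ≤ H i × H i < l ×
    W j < W i × W i < W k × W k < W l)
  Contains1423 = ∃[ i ] ∃[ j ] ∃[ k ] ∃[ l ] (i < j × j < k × k < l × l ≤ H j × k ≤ H i × H i < l ×
    W i < W k × W k < W l × W l < W j)
  Contains2314 = ∃[ i ] ∃[ j ] ∃[ k ] ∃[ l ] (i < j × j < k × k < l × l ≤ H j × k ≤ H i × H i < l ×
    W k < W i × W i < W j × W j < W l)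

  Positions5 : Fin n → Fin n → Fin n → Fin n → Fin n → Set
  Positions5 i j k l m = i < j × j < k × k ≤ H i × H i < l × l ≤ H j × H j < m × m ≤ H k

  Contains25314 Contains24315 Contains14325 Contains15324 : Set
  Contains25314 = ∃[ i ] ∃[ j ] ∃[ k ] ∃[ l ] ∃[ m ] (Positions5 i j k l m ×
    W l < W i × W i < W k × W k < W m × W m < W j)
  Contains24315 = ∃[ i ] ∃[ j ] ∃[ k ] ∃[ l ] ∃[ m ] (Positions5 i j k l m ×
    W l < W i × W i < W k × W k < W j × W j < W m)
  Contains14325 = ∃[ i ] ∃[ j ] ∃[ k ] ∃[ l ] ∃[ m ] (Positions5 i j k l m ×
    W i < W l × W l < W k × W k < W j × W j < W m)
  Contains15324 = ∃[ i ] ∃[ j ] ∃[ k ] ∃[ l ] ∃[ m ] (Positions5 i j k l m ×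
    W i < W l × W l < W k × W k < W m × W m < W j)

  AvoidsAllPatterns : Set
  AvoidsAllPatterns =
    ¬ Contains2143 × ¬ Contains1324 × ¬ Contains1243 × ¬ Contains2134 × ¬ Contains1423 ×
    ¬ Contains2314 × ¬ Contains25314 × ¬ Contains24315 × ¬ Contains14325 × ¬ Contains15324

{-# OPTIONS --safe #-}
module Submission where

-- Idea. Left multiplication identifies Γ_{w,h} with the graph on [g , w₀], g = w̃, and
-- the patterns only compare values across edges, so w may be replaced by g. Every u in
-- [g , w₀] lies in the hull of g: u p is at least the minimum of g on positions ≤ p (Lo)
-- and at most its maximum on positions ≥ p (Hi). Let good(u) be the number of edges whose
-- swap keeps u in the hull, an upper bound for the degree of u. Exchanging two consecutive
-- values c at p and c+1 at q, p < q, never decreases good (a rearrangement inequality), and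
-- every u climbs to w₀ by such exchanges; at w₀ the degree equals good.
--
-- If the graph is regular, then good is constant on [g , w₀] and equals the number of
-- ascending edges of g. The equality case of the rearrangement inequality, applied to
-- permutations obtained from g by a few upward swaps, excludes all patterns. Conversely, for
-- a generator avoiding 2143 and 1324 the hull is all of [g , w₀] (a failure of the rank
-- condition produces one of the two patterns), and avoidance of the other patterns forces
-- equality in every exchange, so the degree is good(w₀) everywhere.

-- Equality in the exchanges is not matched with the patterns directly. Between them stand
-- `LeftSplit` and its mirror image under reversing positions and values. Equality implies both, by
-- moving a few values of g upwards; conversely, together with avoidance of 2143 they give equality
-- back. The reversal exchanges 1243 with 2134 and 1423 with 2314, fixes 2143 and 1324, and permutes
-- the four patterns of length five, so each argument is written once, for an abstract `Setting`.
-- The four patterns of length five form one condition: they differ only in the comparisons at (i ,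
-- l) and (j , m), which are not edges, so that w and g may disagree there. Lying in the hull may be
-- weaker than lying above g, so a hull edge need not lead into the interval. For w₀ with one good
-- swap the two notions agree without any hypothesis on patterns; this makes w₀ the right place to
-- compare `good` with the degree.

open import Defs
open import Data.Nat as ℕ using (ℕ; zero; suc; _+_; z≤n; s≤s)
import Data.Nat.Properties as ℕₚ
open import Data.Fin as Fin using (Fin; zero; suc; toℕ; fromℕ<; opposite)
import Data.Fin.Properties as Finₚ
open import Data.Fin.Permutation using (Permutation′; _⟨$⟩ʳ_; _⟨$⟩ˡ_; inverseˡ; inverseʳ; permutation)
open import Data.Fin.Permutation.Components using (transpose)
open import Data.List using (List; []; _∷_; length; filter; cartesianProduct; allFin; tabulate; map; _++_)
import Data.List.Properties as Listₚ
open import Data.List.Membership.Propositional using (_∈_; find)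
open import Data.List.Membership.Propositional.Properties using (∈-filter⁺; ∈-filter⁻; ∈-cartesianProduct⁺; ∈-allFin)
open import Data.List.Relation.Unary.Any as Any using (Any; here; there)
import Data.List.Relation.Unary.Any.Properties as Anyₚ
open import Data.List.Relation.Unary.All as All using (All; []; _∷_)
import Data.List.Relation.Unary.All.Properties as Allₚ
open import Data.List.Relation.Unary.AllPairs using (AllPairs; []; _∷_)
open import Data.List.Relation.Unary.Unique.Propositional using (Unique)
import Data.List.Relation.Unary.Unique.Propositional.Properties as Uniqueₚ
open import Data.Product using (∃; ∃₂; _×_; _,_; proj₁; proj₂)
open import Data.Product.Properties using (×-≡,≡→≡)
open import Data.Sum using (_⊎_; inj₁; inj₂; [_,_]′)
open import Data.Empty using (⊥; ⊥-elim)
open import Function using (flip; _∘_; id; _⇔_; mk⇔; Equivalence)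
open import Relation.Nullary using (¬_; Dec; yes; no)
open import Relation.Nullary.Decidable using (¬?; _×-dec_; decidable-stable)
open import Relation.Nullary.Negation using (contradiction)
open import Relation.Binary using (IsStrictTotalOrder; tri<; tri≈; tri>)
open import Relation.Binary.PropositionalEquality using (_≡_; _≢_; _≗_; refl; sym; trans; subst; subst₂; cong; cong₂; module ≡-Reasoning)
import Relation.Binary.Construct.Flip.EqAndOrd as Flip
open import Relation.Unary using (Decidable)
open import Algebra.Properties.CommutativeMonoid.Sum ℕₚ.+-0-commutativeMonoid using (sum; sum-cong-≗; ∑-distrib-+; sum-permute)
open import Algebra.Properties.CommutativeSemigroup ℕₚ.+-commutativeSemigroup using (x∙yz≈y∙xz)

-- Generators up to reversing positions and values

module StrictTotal {n : ℕ} {_<_ : Fin n → Fin n → Set} (sto : IsStrictTotalOrder _≡_ _<_) where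
  open IsStrictTotalOrder sto public using (compare; _<?_; _≟_) renaming (trans to <-trans)
  open IsStrictTotalOrder sto using (irrefl)

  infix 4 _≤_ _≤?_ _⋖_

  -- Defined by negation so that flipping _<_ flips _≤_ definitionally.
  _≤_ : Fin n → Fin n → Set
  x ≤ y = ¬ (y < x)

  _⋖_ : Fin n → Fin n → Set
  x ⋖ y = x < y × (∀ {z} → x < z → z < y → ⊥)

  _≤?_ : ∀ x y → Dec (x ≤ y)
  x ≤? y = ¬? (y <? x)

  <-irrefl : ∀ {x} → ¬ (x < x)
  <-irrefl = irrefl refl

  <⇒≤ : ∀ {x y} → x < y → x ≤ y
  <⇒≤ x<y y<x = <-irrefl (<-trans x<y y<x)

  <⇒≢ : ∀ {x y} → x < y → x ≢ y
  <⇒≢ x<y refl = <-irrefl x<y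

  ≤-refl : ∀ {x} → x ≤ x
  ≤-refl = <-irrefl

  ≤-<-trans : ∀ {x y z} → x ≤ y → y < z → x < z
  ≤-<-trans {x} {y} x≤y y<z with compare x y
  ... | tri< x<y _ _  = <-trans x<y y<z
  ... | tri≈ _ refl _ = y<z
  ... | tri> _ _ y<x  = contradiction y<x x≤y

  <-≤-trans : ∀ {x y z} → x < y → y ≤ z → x < z
  <-≤-trans {_} {y} {z} x<y y≤z with compare y z
  ... | tri< y<z _ _  = <-trans x<y y<z
  ... | tri≈ _ refl _ = x<y
  ... | tri> _ _ z<y  = contradiction z<y y≤z

  ≤-trans : ∀ {x y z} → x ≤ y → y ≤ z → x ≤ z
  ≤-trans x≤y y≤z z<x = y≤z (<-≤-trans z<x x≤y)

  ≤∧≢⇒< : ∀ {x y} → x ≤ y → x ≢ y → x < y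
  ≤∧≢⇒< {x} {y} x≤y x≢y with compare x y
  ... | tri< x<y _ _ = x<y
  ... | tri≈ _ x≡y _ = contradiction x≡y x≢y
  ... | tri> _ _ y<x = contradiction y<x x≤y

  ≤-antisym : ∀ {x y} → x ≤ y → y ≤ x → x ≡ y
  ≤-antisym {x} {y} x≤y y≤x with compare x y
  ... | tri< x<y _ _ = contradiction x<y y≤x
  ... | tri≈ _ x≡y _ = x≡y
  ... | tri> _ _ y<x = contradiction y<x x≤y

-- A generator w for a Hessenberg function, presented so that the symmetry
-- reversing both positions and values acts on it: E i j means i < j ≤ h(i).
record Setting (n : ℕ) : Set₁ where
  field
    _<_  : Fin n → Fin n → Set
    sto  : IsStrictTotalOrder _≡_ _<_
  open StrictTotal sto public
  field
    -- A discrete intermediate value principle. Consecutive elements are described by an empty gap,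
    -- not by a successor, so that the principle survives reversal of the order.
    cross : ∀ {P : Fin n → Set} → Decidable P → ∀ {a b} → a < b → ¬ P a → P b →
      ∃₂ λ c c′ → a ≤ c × c ⋖ c′ × c′ ≤ b × ¬ P c × P c′
    E        : Fin n → Fin n → Set
    E?       : ∀ i j → Dec (E i j)
    E⇒<      : ∀ {i j} → E i j → i < j
    E-shrink : ∀ {i j i′ j′} → E i j → i ≤ i′ → i′ < j′ → j′ ≤ j → E i′ j′
    w pos    : Fin n → Fin n
    w-pos    : ∀ a → w (pos a) ≡ a
    pos-w    : ∀ x → pos (w x) ≡ x
    -- If c′ occurs before c, the generator inequality holds by `extensive`; only consecutive values
    -- in increasing positions carry information.
    gen      : ∀ {c c′} → c ⋖ c′ → pos c < pos c′ → E (pos c) (pos c′)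

-- Positions and values share the type `Fin n`, so flipping one order reverses both. As `w` and
-- `pos` stay the same, `Hi` of the reversed setting is definitionally `Lo` of the original one, and
-- dual statements need no transport.
op : ∀ {n} → Setting n → Setting n
op S = record
  { _<_      = flip _<_
  ; sto      = Flip.isStrictTotalOrder sto
  ; cross    = λ P? b<a ¬Pa Pb → case-op P? (cross (λ x → ¬? (P? x)) b<a (contradiction Pb) ¬Pa)
  ; E        = flip E
  ; E?       = flip E?
  ; E⇒<      = E⇒<
  ; E-shrink = λ e p q r → E-shrink e r q p
  ; w        = w
  ; pos      = pos
  ; w-pos    = w-pos
  ; pos-w    = pos-w
  ; gen      = λ (c<c′ , gap) → gen (c<c′ , λ p q → gap q p)
  }
  where
  open Setting S
  case-op : ∀ {P : Fin _ → Set} → Decidable P → ∀ {a b} →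
    (∃₂ λ c c′ → b ≤ c × c ⋖ c′ × c′ ≤ a × ¬ ¬ P c × ¬ P c′) →
    ∃₂ λ c c′ → c ≤ a × (c′ < c × (∀ {z} → z < c → c′ < z → ⊥)) × b ≤ c′ × ¬ P c × P c′
  case-op P? (c , c′ , b≤c , (c<c′ , gap) , c′≤a , ¬¬Pc , ¬Pc′) =
    c′ , c , c′≤a , (c<c′ , λ p q → gap q p) , b≤c , ¬Pc′ , decidable-stable (P? c) ¬¬Pc

-- Hull conditions, patterns and the split condition

module Theory {n : ℕ} (S : Setting n) where
  open Setting S public

  w-injective : ∀ {x y} → w x ≡ w y → x ≡ y
  w-injective {x} {y} e = trans (sym (pos-w x)) (trans (cong pos e) (pos-w y))

  ≢-of-w< : ∀ {x y} → w x < w y → x ≢ y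
  ≢-of-w< wx<wy refl = <-irrefl wx<wy

  Hi Lo : Fin n → Fin n → Set
  Hi a j = ∃ λ r → j ≤ r × a ≤ w r
  Lo a i = ∃ λ q → q ≤ i × w q ≤ a

  Hi? : ∀ a j → Dec (Hi a j)
  Hi? a j = Finₚ.any? (λ r → (j ≤? r) ×-dec (a ≤? w r))

  Lo? : ∀ a i → Dec (Lo a i)
  Lo? a i = Finₚ.any? (λ q → (q ≤? i) ×-dec (w q ≤? a))

  Hi-mono : ∀ {a b i j} → b ≤ a → j ≤ i → Hi a i → Hi b j
  Hi-mono b≤a j≤i (r , i≤r , a≤wr) = r , ≤-trans j≤i i≤r , ≤-trans b≤a a≤wr

  Lo-mono : ∀ {a b i j} → a ≤ b → i ≤ j → Lo a i → Lo b j
  Lo-mono a≤b i≤j (q , q≤i , wq≤a) = q , ≤-trans q≤i i≤j , ≤-trans wq≤a a≤b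

  InHull : (Fin n → Fin n) → Set
  InHull u = ∀ p → Hi (u p) p × Lo (u p) p

  Avoid2143 Avoid1324 Avoid1243 Avoid1423 Avoid5 : Set
  Avoid2143 = ∀ {i j k l} → i < j → j < k → k < l → E i l →
    w j < w i → w i < w l → w l < w k → ⊥
  Avoid1324 = ∀ {i j k l} → i < j → j < k → k < l → E j l → E i k →
    w i < w k → w k < w j → w j < w l → ⊥
  Avoid1243 = ∀ {i j k l} → i < j → j < k → k < l → E j l → E i j → ¬ E i l →
    w i < w j → w j < w l → w l < w k → ⊥
  Avoid1423 = ∀ {i j k l} → i < j → j < k → k < l → E j l → E i k → ¬ E i l →
    w i < w k → w k < w l → w l < w j → ⊥
  -- The common part of 25314, 24315, 14325 and 15324.
  Avoid5 = ∀ {i j k l m} → i < j → j < k → k < l → l < m →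
    E i k → ¬ E i l → E j l → ¬ E j m → E k m →
    w i < w k → w l < w k → w k < w j → w k < w m → ⊥

  -- The link between patterns and `StepEq`: a left neighbour `i′` of `j` above everything from `j`
  -- on forces the non-neighbours left of `j` to be above it as well. It is used to deduce an edge
  -- from an ascent.
  LeftSplit : Set
  LeftSplit = ∀ {i i′ j k} → i < j → ¬ E i j → E i′ j → ¬ Hi (w i′) j →
    j ≤ k → w i < w k → ⊥

  -- The generator condition enters here. On the way up from `w i` to `w k`, some pair of
  -- consecutive values leaves `D`; since `D` is closed downwards, the smaller one also stands
  -- further left, and `gen` joins their positions.
  genCross : ∀ {D : Fin n → Set} → Decidable D → (∀ {x y} → x < y → D y → D x) →
    ∀ {i k} → D i → ¬ D k → w i < w k →
    ∃₂ λ x y → D x × ¬ D y × E x y × w i ≤ w x × w x < w y × w y ≤ w k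
  genCross {D} D? down {i} {k} Di ¬Dk wi<wk
    with cross (λ v → ¬? (D? (pos v))) wi<wk
           (λ ¬D → ¬D (subst D (sym (pos-w i)) Di)) (λ d → ¬Dk (subst D (pos-w k) d))
  ... | c , c′ , wi≤c , c⋖c′ , c′≤wk , ¬¬Dc , ¬Dc′ =
    pos c , pos c′ , Dc , ¬Dc′ , gen c⋖c′ pc<pc′ ,
    subst (w i ≤_) (sym (w-pos c)) wi≤c ,
    subst (λ z → z < w (pos c′)) (sym (w-pos c)) (subst (c <_) (sym (w-pos c′)) (proj₁ c⋖c′)) ,
    subst (_≤ w k) (sym (w-pos c′)) c′≤wk
    where
    Dc : D (pos c)
    Dc = decidable-stable (D? (pos c)) ¬¬Dc
    pc<pc′ : pos c < pos c′
    pc<pc′ with compare (pos c) (pos c′)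
    ... | tri< lt _ _ = lt
    ... | tri≈ _ eq _ = contradiction (subst D eq Dc) ¬Dc′
    ... | tri> _ _ gt = contradiction (down gt Dc) ¬Dc′

  module _ (no1243 : Avoid1243) (no1423 : Avoid1423) (no5 : Avoid5) where

    -- The ascent from `i₀` to `k` is refined twice by `genCross`: to an edge i → p that enters the
    -- neighbours of `j`, and to an edge q → r across `j`. Then w i < w p ≤ w q < w r ≤ w k < w b.
    -- The place of `b` among these positions and the missing edges decide which pattern appears.
    leftSplit : LeftSplit
    leftSplit {i₀} {b} {j} {k} i₀<j ¬Ei₀j Ebj ¬Hi j≤k wi₀<wk
      with genCross {D = λ x → x < j × ¬ E x j} (λ x → (x <? j) ×-dec ¬? (E? x j))
             (λ { x<y (y<j , ¬Eyj) → <-trans x<y y<j ,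
                  λ Exj → ¬Eyj (E-shrink Exj (<⇒≤ x<y) y<j ≤-refl) })
             (i₀<j , ¬Ei₀j) (λ (k<j , _) → j≤k k<j) wi₀<wk
    ... | i , p , (i<j , ¬Eij) , ¬Dp , Eip , _ , wi<wp , wp≤wk = main
      where
      E-left : ∀ {x y} → E x y → x < j → j ≤ y → E x j
      E-left Exy x<j j≤y = E-shrink Exy ≤-refl x<j j≤y
      p<j : p < j
      p<j = decidable-stable (p <? j) (λ j≤p → ¬Eij (E-left Eip i<j j≤p))
      Epj : E p j
      Epj = decidable-stable (E? p j) (λ ¬E → ¬Dp (p<j , ¬E))
      wp<wk : w p < w k
      wp<wk = ≤∧≢⇒< wp≤wk λ e → j≤k (subst (_< j) (w-injective e) p<j)
      below-b : ∀ {r} → j ≤ r → w r < w b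
      below-b {r} j≤r = decidable-stable (w r <? w b) λ wb≤wr → ¬Hi (r , j≤r , wb≤wr)
      b<j : b < j
      b<j = E⇒< Ebj
      i<b : i < b
      i<b = decidable-stable (i <? b) λ b≤i → ¬Eij (E-shrink Ebj b≤i i<j ≤-refl)
      wk<wb : w k < w b
      wk<wb = below-b j≤k
      main : ⊥
      main with genCross {D = _< j} (_<? j) <-trans p<j j≤k wp<wk
      ... | q , r , q<j , j≤r , Eqr , wp≤wq , wq<wr , wr≤wk = go
        where
        wq<wb : w q < w b
        wq<wb = <-trans wq<wr (below-b j≤r)
        wp<wr : w p < w r
        wp<wr = ≤-<-trans wp≤wq wq<wr
        wi<wq : w i < w q
        wi<wq = <-≤-trans wi<wp wp≤wq
        ¬Eir : ¬ E i r
        ¬Eir Eir = ¬Eij (E-left Eir i<j j≤r)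
        b<r : b < r
        b<r = <-≤-trans b<j j≤r
        E-to-q : ∀ {x} → E x j → x < q → E x q
        E-to-q Exj x<q = E-shrink Exj ≤-refl x<q (<⇒≤ q<j)
        -- The five positions are i, b, q, j, r. Here `j` differs from `r` because `b` is joined to
        -- `j` but not to `r`.
        five : E i q → b < q → ¬ E b r → w j < w q → ⊥
        five Eiq b<q ¬Ebr wj<wq =
          no5 i<b b<q q<j (≤∧≢⇒< j≤r λ { refl → ¬Ebr Ebj })
            Eiq ¬Eij Ebj ¬Ebr Eqr wi<wq wj<wq wq<wb wq<wr
        case-b<p : b < p → ⊥
        case-b<p b<p with E? b r
        ... | yes Ebr = no1423 i<b b<p (<-≤-trans p<j j≤r) Ebr Eip ¬Eir wi<wp wp<wr (below-b j≤r)
        ... | no ¬Ebr with compare (w j) (w p)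
        ...   | tri> _ _ wp<wj = no1423 i<b b<p p<j Ebj Eip ¬Eij wi<wp wp<wj (below-b ≤-refl)
        ...   | tri≈ _ e _ = contradiction (w-injective (sym e)) (<⇒≢ p<j)
        ...   | tri< wj<wp _ _ with E? i q
        ...     | yes Eiq = five Eiq b<q ¬Ebr (<-≤-trans wj<wp wp≤wq)
          where
          b<q : b < q
          b<q = decidable-stable (b <? q) λ q≤b → ¬Ebr (E-shrink Eqr q≤b b<r ≤-refl)
        ...     | no ¬Eiq = no1423 i<b b<p p<q (E-to-q Ebj b<q) Eip ¬Eiq wi<wp
                              (≤∧≢⇒< wp≤wq λ e → <⇒≢ p<q (w-injective e)) wq<wb
          where
          b<q : b < q
          b<q = decidable-stable (b <? q) λ q≤b → ¬Ebr (E-shrink Eqr q≤b b<r ≤-refl)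
          p<q : p < q
          p<q = decidable-stable (p <? q) λ q≤p →
            ¬Eiq (E-shrink Eip ≤-refl (<-trans i<b b<q) q≤p)
        case-p<b : p < b → ⊥
        case-p<b p<b with E? p r
        ... | yes Epr = no1243 (E⇒< Eip) p<b b<r Epr Eip ¬Eir wi<wp wp<wr (below-b j≤r)
        ... | no ¬Epr with compare (w j) (w p)
        ...   | tri> _ _ wp<wj = no1243 (E⇒< Eip) p<b b<j Epj Eip ¬Eij wi<wp wp<wj (below-b ≤-refl)
        ...   | tri≈ _ e _ = contradiction (w-injective (sym e)) (<⇒≢ p<j)
        ...   | tri< wj<wp _ _ = rest (compare q b) (E? i q)
          where
          p<q : p < q
          p<q = decidable-stable (p <? q) λ q≤p →
            ¬Epr (E-shrink Eqr q≤p (<-≤-trans p<j j≤r) ≤-refl)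
          wp<wq : w p < w q
          wp<wq = ≤∧≢⇒< wp≤wq λ e → <⇒≢ p<q (w-injective e)
          rest : _ → Dec (E i q) → ⊥
          rest (tri≈ _ e _) _ = ≢-of-w< wq<wb e
          rest (tri< q<b _ _) (yes Eiq) =
            no1243 (E⇒< Eiq) q<b b<r Eqr Eiq ¬Eir wi<wq wq<wr (below-b j≤r)
          rest (tri< q<b _ _) (no ¬Eiq) =
            no1243 p<q q<b b<r Eqr (E-to-q Epj p<q) ¬Epr wp<wq wq<wr (below-b j≤r)
          rest (tri> _ _ b<q) (no ¬Eiq) =
            no1243 (E⇒< Eip) p<b b<q (E-to-q Epj p<q) Eip ¬Eiq wi<wp wp<wq wq<wb
          rest (tri> _ _ b<q) (yes Eiq) with E? b r
          ... | yes Ebr = no1423 i<b b<q (<-≤-trans q<j j≤r) Ebr Eiq ¬Eir wi<wq wq<wr (below-b j≤r)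
          ... | no ¬Ebr = five Eiq b<q ¬Ebr (<-trans wj<wp wp<wq)
        go : ⊥
        go with compare p b
        ... | tri< p<b _ _ = case-p<b p<b
        ... | tri≈ _ e _ = ≢-of-w< (≤-<-trans wp≤wk wk<wb) e
        ... | tri> _ _ b<p = case-b<p b<p

  -- Exactly the condition under which exchanging the consecutive values u p ⋖ u q
  -- (p < q) does not change the number of hull edges joining k < p to {p , q}.
  StepEq : (Fin n → Fin n) → Set
  StepEq u = ∀ {k p q} → p < q → u p ⋖ u q → k < p → Lo (u q) k → ¬ Lo (u p) k →
    E k p → Hi (u k) p → E k q × Hi (u k) q

  GoodAscends : Set
  GoodAscends = ∀ {x y} → E x y → Hi (w x) y → Lo (w y) x → w x < w y

  record LoJump (c c′ k : Fin n) : Set where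
    field
      q₀    : Fin n
      q₀≤k  : q₀ ≤ k
      w-q₀  : w q₀ ≡ c′
      k<pos : k < pos c

  -- No value lies between `c` and `c′`, so `c′` itself is the minimum of `w` on positions up to
  -- `k`, and `c` can only occur later.
  loJump : ∀ {c c′ k} → c ⋖ c′ → Lo c′ k → ¬ Lo c k → LoJump c c′ k
  loJump {c} {c′} {k} (c<c′ , gap) (q , q≤k , wq≤c′) ¬Lo = record
    { q₀ = q ; q₀≤k = q≤k
    ; w-q₀ = ≤-antisym wq≤c′ λ wq<c′ → gap (decidable-stable (c <? w q) λ wq≤c → ¬Lo (q , q≤k , wq≤c)) wq<c′
    ; k<pos = decidable-stable (k <? pos c) λ pc≤k →
        ¬Lo (pos c , pc≤k , subst (_≤ c) (sym (w-pos c)) ≤-refl) }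

module Dual {n : ℕ} (S : Setting n) = Theory (op S)

-- From avoidance and split conditions to equality and to the rank criterion

module Splits {n : ℕ} (S : Setting n) where
  open Theory S

  RightSplit : Set
  RightSplit = Dual.LeftSplit S

  -- The hull translates `u` into `w`: there are `t ≤ p` with `w t` at most `u p` and `s ≥ q` with
  -- `w s` at least `u q`. As `w t` is below everything up to `k`, `rightSplit` forces the edge from
  -- `k` to `q`. If `Hi (u k) q` failed, 2143 would appear at q₀, t, r, s, where `q₀` carries `u q`,
  -- the minimum of `w` up to `k`.
  stepEq : LeftSplit → RightSplit → Avoid2143 → ∀ {u} → InHull u → StepEq u
  stepEq leftSplit rightSplit no2143 {u} hull {k} {p} {q} p<q c⋖c′ k<p Lo-c′ ¬Lo-c Ekp (r , p≤r , uk≤wr) =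
    Ekq , decidable-stable (Hi? (u k) q) no-Hi
    where
    open LoJump (loJump c⋖c′ Lo-c′ ¬Lo-c)
    t s : Fin n
    t = proj₁ (proj₂ (hull p))
    s = proj₁ (proj₁ (hull q))
    t≤p : t ≤ p
    t≤p = proj₁ (proj₂ (proj₂ (hull p)))
    wt≤c : w t ≤ u p
    wt≤c = proj₂ (proj₂ (proj₂ (hull p)))
    q≤s : q ≤ s
    q≤s = proj₁ (proj₂ (proj₁ (hull q)))
    k<t : k < t
    k<t = decidable-stable (k <? t) λ t≤k → ¬Lo-c (t , t≤k , wt≤c)
    k<q : k < q
    k<q = <-trans k<p p<q
    c′<ws : w q₀ < w s
    c′<ws = ≤∧≢⇒< (subst (_≤ w s) (sym w-q₀) (proj₂ (proj₂ (proj₁ (hull q)))))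
      λ e → q≤s (subst (_< q) (w-injective e) (≤-<-trans q₀≤k k<q))
    wt<c′ : w t < w q₀
    wt<c′ = subst (w t <_) (sym w-q₀) (≤-<-trans wt≤c (proj₁ c⋖c′))
    ¬Lo-t : ∀ {x} → x ≤ k → ¬ Lo (w t) x
    ¬Lo-t x≤k lo = ¬Lo-c (Lo-mono wt≤c x≤k lo)
    Ekq : E k q
    Ekq = decidable-stable (E? k q) λ ¬Ekq →
      rightSplit (<-≤-trans k<q q≤s) (λ Eks → ¬Ekq (E-shrink Eks ≤-refl k<q q≤s))
        (E-shrink Ekp ≤-refl k<t t≤p) (¬Lo-t ≤-refl) q₀≤k c′<ws
    no-Hi : ¬ ¬ Hi (u k) q
    no-Hi ¬Hi-q = no2143 q₀<t t<r (<-≤-trans r<q q≤s) Eq₀s wt<c′ c′<ws ws<wr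
      where
      r<q : r < q
      r<q = decidable-stable (r <? q) λ q≤r → ¬Hi-q (r , q≤r , uk≤wr)
      ¬Hi-r : ¬ Hi (w r) q
      ¬Hi-r hi = ¬Hi-q (Hi-mono uk≤wr ≤-refl hi)
      ws<wr : w s < w r
      ws<wr = decidable-stable (w s <? w r) λ wr≤ws → ¬Hi-r (s , q≤s , wr≤ws)
      q₀<t : q₀ < t
      q₀<t = ≤-<-trans q₀≤k k<t
      t<r : t < r
      t<r = ≤∧≢⇒< (≤-trans t≤p p≤r) (≢-of-w< (<-trans wt<c′ (<-trans c′<ws ws<wr)))
      q₀<q : q₀ < q
      q₀<q = ≤-<-trans q₀≤k k<q
      Eq₀q : E q₀ q
      Eq₀q = decidable-stable (E? q₀ q) λ ¬E →
        leftSplit q₀<q ¬E (E-shrink Ekq (<⇒≤ (<-≤-trans k<p p≤r)) r<q ≤-refl) ¬Hi-r q≤s c′<ws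
      Eq₀s : E q₀ s
      Eq₀s = decidable-stable (E? q₀ s) λ ¬E →
        rightSplit (<-≤-trans q₀<q q≤s) ¬E
          (E-shrink Eq₀q ≤-refl q₀<t (≤-trans t≤p (<⇒≤ p<q))) (¬Lo-t q₀≤k) ≤-refl c′<ws

  -- Cutting the ascents from `q` to `pos b` and from `pos a` to `s` at the boundary between `p` and
  -- `p′` gives edges q′ → y and x → s′ across it, with w q′ < w y < w x < w s′. Every relative
  -- order of these positions, completed by `p` or `p′` where necessary, contains 2143 or 1324.
  corner : Avoid2143 → Avoid1324 → ∀ {p p′ a b q s} → p ⋖ p′ → b < a →
    a ≤ w p → w p′ ≤ b → pos a ≤ p → p′ ≤ pos b → q ≤ p → w q ≤ b → p′ ≤ s → a ≤ w s → ⊥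
  corner no2143 no1324 {p} {p′} {a} {b} {q} {s} (p<p′ , gap) b<a a≤wp wp′≤b pa≤p p′≤pb q≤p wq≤b p′≤s a≤ws
    with genCross {D = _≤ p} (_≤? p) (λ x<y y≤p → ≤-trans (<⇒≤ x<y) y≤p)
           q≤p (λ pb≤p → pb≤p (<-≤-trans p<p′ p′≤pb)) wq<b
       | genCross {D = _≤ p} (_≤? p) (λ x<y y≤p → ≤-trans (<⇒≤ x<y) y≤p)
           pa≤p (λ s≤p → s≤p (<-≤-trans p<p′ p′≤s)) a<ws
    where
    wq<b : w q < w (pos b)
    wq<b = ≤∧≢⇒< (subst (w q ≤_) (sym (w-pos b)) wq≤b)
      λ e → p′≤pb (subst (_< p′) (w-injective e) (≤-<-trans q≤p p<p′))
    a<ws : w (pos a) < w s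
    a<ws = ≤∧≢⇒< (subst (_≤ w s) (sym (w-pos a)) a≤ws)
      λ e → p′≤s (subst (_< p′) (w-injective e) (≤-<-trans pa≤p p<p′))
  ... | q′ , y , q′≤p , ¬y≤p , Eq′y , _ , wq′<wy , wy≤b
      | x , s′ , x≤p , ¬s′≤p , Exs′ , a≤wx , wx<ws′ , _ = go (compare (w p) (w s′)) (compare (w p′) (w q′)) (compare y s′) (compare x q′)
    where
    above : ∀ {z} → ¬ (z ≤ p) → p′ ≤ z
    above ¬z≤p z<p′ = ¬z≤p λ p<z → gap p<z z<p′
    wy<a : w y < a
    wy<a = ≤-<-trans (subst (w y ≤_) (w-pos b) wy≤b) b<a
    wa≤wx : a ≤ w x
    wa≤wx = subst (_≤ w x) (w-pos a) a≤wx
    wy<wx : w y < w x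
    wy<wx = <-≤-trans wy<a wa≤wx
    wy<wp : w y < w p
    wy<wp = <-≤-trans wy<a a≤wp
    q′<p : q′ < p
    q′<p = ≤∧≢⇒< q′≤p (≢-of-w< (<-trans wq′<wy wy<wp))
    wp′<a : w p′ < a
    wp′<a = ≤-<-trans wp′≤b b<a
    p′<s′ : p′ < s′
    p′<s′ = ≤∧≢⇒< (above ¬s′≤p) (≢-of-w< (<-trans (<-≤-trans wp′<a wa≤wx) wx<ws′))
    p′≤y : p′ ≤ y
    p′≤y = above ¬y≤p
    p<s′ : p < s′
    p<s′ = <-trans p<p′ p′<s′
    q′<p′ : q′ < p′
    q′<p′ = <-trans q′<p p<p′
    Eq′p′ : E q′ p′
    Eq′p′ = E-shrink Eq′y ≤-refl q′<p′ p′≤y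
    Eps′ : E p s′
    Eps′ = E-shrink Exs′ x≤p p<s′ ≤-refl
    x<y : x < y
    x<y = ≤-<-trans x≤p (<-≤-trans p<p′ p′≤y)
    2143-low : s′ < y → w p′ < w q′ → ⊥
    2143-low s′<y wp′<wq′ =
      no2143 q′<p′ p′<s′ s′<y Eq′y wp′<wq′ wq′<wy (<-trans wy<wx wx<ws′)
    go : _ → _ → _ → _ → ⊥
    go (tri≈ _ e _) _ _ _ = <⇒≢ p<s′ (w-injective e)
    go _ (tri≈ _ e _) _ _ = <⇒≢ q′<p′ (w-injective (sym e))
    go _ _ (tri≈ _ e _) _ = ≢-of-w< (<-trans wy<wx wx<ws′) e
    go _ _ _ (tri≈ _ e _) = ≢-of-w< (<-trans wq′<wy wy<wx) (sym e)
    go (tri< wp<ws′ _ _) (tri> _ _ wq′<wp′) _ _ =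
      no1324 q′<p p<p′ p′<s′ Eps′ Eq′p′ wq′<wp′ (<-≤-trans wp′<a a≤wp) wp<ws′
    go (tri< wp<ws′ _ _) (tri< wp′<wq′ _ _) (tri< y<s′ _ _) _ =
      no1324 q′<p (<-≤-trans p<p′ p′≤y) y<s′ Eps′ Eq′y wq′<wy wy<wp wp<ws′
    go (tri< _ _ _) (tri< wp′<wq′ _ _) (tri> _ _ s′<y) _ = 2143-low s′<y wp′<wq′
    go (tri> _ _ ws′<wp) _ _ (tri< x<q′ _ _) =
      no2143 x<q′ q′<p p<s′ Exs′ (<-trans wq′<wy wy<wx) wx<ws′ ws′<wp
    go (tri> _ _ _) _ (tri< y<s′ _ _) (tri> _ _ q′<x) =
      no1324 q′<x x<y y<s′ Exs′ Eq′y wq′<wy wy<wx wx<ws′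
    go (tri> _ _ _) (tri> _ _ wq′<wp′) (tri> _ _ _) (tri> _ _ q′<x) =
      no1324 q′<x (≤-<-trans x≤p p<p′) p′<s′ Exs′ Eq′p′ wq′<wp′ (<-≤-trans wp′<a wa≤wx) wx<ws′
    go (tri> _ _ _) (tri< wp′<wq′ _ _) (tri> _ _ s′<y) (tri> _ _ _) = 2143-low s′<y wp′<wq′

-- From equality to the split condition and to pattern avoidance

module Equality {n : ℕ} (S : Setting n) (ascent : Theory.GoodAscends S) where
  open Theory S

  hull-inversion : ∀ {x y} → E x y → w y < w x → Lo (w y) x → ¬ Hi (w x) y
  hull-inversion Exy wy<wx lo hi = <⇒≤ wy<wx (ascent Exy hi lo)

  avoid1324 : Avoid1324
  avoid1324 {i} {j} {k} {l} i<j j<k k<l Ejl Eik wi<wk wk<wj wj<wl =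
    hull-inversion (E-shrink Ejl ≤-refl j<k (<⇒≤ k<l)) wk<wj
      (i , <⇒≤ i<j , <⇒≤ wi<wk) (l , <⇒≤ k<l , <⇒≤ wj<wl)

  module _ (leftSplit : LeftSplit) where

    avoid1243 : Avoid1243
    avoid1243 {i} {j} {k} {l} i<j j<k k<l Ejl Eij ¬Eil wi<wj wj<wl wl<wk =
      leftSplit (<-trans i<j (<-trans j<k k<l)) ¬Eil Ekl
        (hull-inversion Ekl wl<wk (j , <⇒≤ j<k , <⇒≤ wj<wl)) ≤-refl (<-trans wi<wj wj<wl)
      where
      Ekl : E k l
      Ekl = E-shrink Ejl (<⇒≤ j<k) k<l ≤-refl

    avoid1423 : Avoid1423
    avoid1423 {i} {j} {k} {l} i<j j<k k<l Ejl Eik ¬Eil wi<wk wk<wl wl<wj =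
      leftSplit (<-trans i<j (<-trans j<k k<l)) ¬Eil Ejl
        (hull-inversion Ejl wl<wj (i , <⇒≤ i<j , <⇒≤ (<-trans wi<wk wk<wl))) ≤-refl (<-trans wi<wk wk<wl)

    -- By `hull-inversion` at the edge from `j` to `k`, the value `w j` exceeds everything from `k`
    -- on, hence everything from `l` on. So `leftSplit` at `l` forbids the ascent from `i` to `m`.
    avoid5 : Avoid5
    avoid5 {i} {j} {k} {l} {m} i<j j<k k<l l<m Eik ¬Eil Ejl ¬Ejm Ekm wi<wk wl<wk wk<wj wk<wm =
      leftSplit (<-trans i<j (<-trans j<k k<l)) ¬Eil Ejl
        (λ hi → hull-inversion (E-shrink Ejl ≤-refl j<k (<⇒≤ k<l)) wk<wj
                  (i , <⇒≤ i<j , <⇒≤ wi<wk) (Hi-mono ≤-refl (<⇒≤ k<l) hi))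
        (<⇒≤ l<m) (<-trans wi<wk wk<wm)

  module _
    -- `In` stands for membership in the interval above g. It serves the reversed setting too,
    -- because reversing positions and values preserves ascending pairs.
    (In : (Fin n → Fin n) → Set) (In-w : In w)
    (up : ∀ {u i j} → In u → i < j → u i < u j →
      ∃ λ v → In v × v i ≡ u j × v j ≡ u i × (∀ {k} → k ≢ i → k ≢ j → v k ≡ u k))
    (stepEq : ∀ {u} → In u → StepEq u)
    where

    -- The hypotheses say that c′ is the minimum of w on positions ≤ i.
    raise : ∀ {c c′ i} → c ⋖ c′ → Lo c′ i → ¬ Lo c i →
      ∃ λ u → In u × u i ≡ c′ × (∀ {x} → i < x → u x ≡ w x)
    raise {c} {c′} {i} c⋖c′@(c<c′ , gap) lo ¬lo with loJump c⋖c′ lo ¬lo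
    ... | record { q₀ = q₀ ; q₀≤k = q₀≤i ; w-q₀ = w-q₀ } with q₀ ≟ i
    ...   | yes refl = w , In-w , w-q₀ , λ _ → refl
    ...   | no q₀≢i with up In-w (≤∧≢⇒< q₀≤i q₀≢i) wq₀<wi
      where
      c<wi : c < w i
      c<wi = decidable-stable (c <? w i) λ wi≤c → ¬lo (i , ≤-refl , wi≤c)
      wq₀<wi : w q₀ < w i
      wq₀<wi = ≤∧≢⇒< (λ wi<wq₀ → gap c<wi (subst (w i <_) w-q₀ wi<wq₀)) (λ e → q₀≢i (w-injective e))
    ...     | v , In-v , _ , v-i , v-x =
      v , In-v , trans v-i w-q₀ ,
      λ i<x → v-x (λ { refl → q₀≤i i<x }) (λ { refl → <-irrefl i<x })

    -- Let `c′` be the minimum of `w` up to `i` and `c` the value just below it. `raise` brings `c′`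
    -- to `i`, and a swap with `j` leaves `w j` at `i` and `c′` at `j`. If `c` sits at a neighbour
    -- of `i`, `StepEq` for the exchange of `c` and `c′` produces the missing edge from `i` to `j`.
    -- Otherwise `c` is first moved to the neighbour `b` by one more upward swap.
    rightSplit : Dual.LeftSplit S
    rightSplit {j} {b} {i} {k} i<j ¬Eij Eib ¬Lo-b k≤i wk<wj
      with cross (λ a → Lo? a i) {w b} {w k}
             (decidable-stable (w b <? w k) λ wk≤wb → ¬Lo-b (k , k≤i , wk≤wb))
             ¬Lo-b (k , k≤i , ≤-refl)
    ... | c , c′ , wb≤c , c⋖c′ , c′≤wk , ¬Lo-c , Lo-c′
      with raise c⋖c′ Lo-c′ ¬Lo-c
    ... | u , In-u , u-i , u-x
      with up In-u i<j (subst (_< u j) (sym u-i) (subst (c′ <_) (sym (u-x i<j)) (≤-<-trans c′≤wk wk<wj)))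
    ... | v , In-v , v-i , v-j , v-x = finish (E? i z)
      where
      z : Fin n
      z = pos c
      i<z : i < z
      i<z = LoJump.k<pos (loJump c⋖c′ Lo-c′ ¬Lo-c)
      c′<wj : c′ < w j
      c′<wj = ≤-<-trans c′≤wk wk<wj
      z≢j : z ≢ j
      z≢j = ≢-of-w< (subst (_< w j) (sym (w-pos c)) (<-trans (proj₁ c⋖c′) c′<wj))
      v-above : ∀ {x} → i < x → x ≢ j → v x ≡ w x
      v-above i<x x≢j = trans (v-x (λ { refl → <-irrefl i<x }) x≢j) (u-x i<x)
      v-z : v z ≡ c
      v-z = trans (v-above i<z z≢j) (w-pos c)
      v-i′ : v i ≡ w j
      v-i′ = trans v-i (u-x i<j)
      v-j′ : v j ≡ c′
      v-j′ = trans v-j u-i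
      clash : ∀ {x} (y : Fin n → Fin n) → In y → y x ≡ c → y i ≡ w j → y j ≡ c′ → E i x → ⊥
      clash {x} y In-y y-x y-i y-j Eix = ¬Eij (proj₁ (stepEq In-y x<j
          (subst (_⋖ y j) (sym y-x) (subst (c ⋖_) (sym y-j) c⋖c′)) (E⇒< Eix)
          (subst (λ a → Lo a i) (sym y-j) Lo-c′) (λ lo → ¬Lo-c (subst (λ a → Lo a i) y-x lo))
          Eix (j , <⇒≤ x<j , subst (_≤ w j) (sym y-i) ≤-refl)))
        where
        x<j : x < j
        x<j = decidable-stable (x <? j) λ j≤x → ¬Eij (E-shrink Eix ≤-refl i<j j≤x)
      finish : Dec (E i z) → ⊥
      finish (yes Eiz) = clash v In-v v-z v-i′ v-j′ Eiz
      finish (no ¬Eiz) with up In-v b<z (subst (_< v z) (sym v-b) (subst (w b <_) (sym v-z) wb<c))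
        where
        b<z : b < z
        b<z = decidable-stable (b <? z) λ z≤b → ¬Eiz (E-shrink Eib ≤-refl i<z z≤b)
        v-b : v b ≡ w b
        v-b = v-above (E⇒< Eib) λ { refl → ¬Eij Eib }
        wb<c : w b < c
        wb<c = ≤∧≢⇒< wb≤c λ e → <⇒≢ b<z (trans (sym (pos-w b)) (cong pos e))
      ... | y , In-y , y-b , y-z , y-x = clash y In-y (trans y-b v-z)
          (trans (y-x (<⇒≢ (E⇒< Eib)) (<⇒≢ i<z)) v-i′)
          (trans (y-x (λ { refl → ¬Eij Eib }) (λ e → z≢j (sym e))) v-j′) Eib

    -- The same device as in `rightSplit`: now `w k` is brought to `i`, `c′` to `l`, and `c` between
    -- `i` and `k`, if necessary to `j`. Then `StepEq` yields `Hi (w k) l`, which `hull-inversion`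
    -- excludes for the inverted edge from `k` to `l`.
    avoid2143 : Avoid2143
    avoid2143 {i} {j} {k} {l} i<j j<k k<l Eil wj<wi wi<wl wl<wk
      with cross (λ a → Lo? a i) wj<wi ¬Lo-j (i , ≤-refl , ≤-refl)
      where
      ¬Lo-j : ¬ Lo (w j) i
      ¬Lo-j lo = hull-inversion (E-shrink Eil ≤-refl i<j (<⇒≤ (<-trans j<k k<l))) wj<wi lo
        (k , <⇒≤ j<k , <⇒≤ (<-trans wi<wl wl<wk))
    ... | c , c′ , wj≤c , c⋖c′ , c′≤wi , ¬Lo-c , Lo-c′
      with raise c⋖c′ Lo-c′ ¬Lo-c
    ... | u , In-u , u-i , u-x
      with up In-u (<-trans i<j j<k)
             (subst (_< u k) (sym u-i) (subst (c′ <_) (sym (u-x (<-trans i<j j<k)))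
               (≤-<-trans c′≤wi (<-trans wi<wl wl<wk))))
    ... | v , In-v , v-i , v-k , v-x
      with up In-v k<l (subst (_< v l) (sym (trans v-k u-i)) (subst (c′ <_) (sym v-l) (≤-<-trans c′≤wi wi<wl)))
      where
      i<l : i < l
      i<l = <-trans i<j (<-trans j<k k<l)
      v-l : v l ≡ w l
      v-l = trans (v-x (λ { refl → <-irrefl i<l }) (λ { refl → <-irrefl k<l })) (u-x i<l)
    ... | x , In-x , x-k , x-l , x-y = finish (z <? k)
      where
      z : Fin n
      z = pos c
      i<k : i < k
      i<k = <-trans i<j j<k
      i<l : i < l
      i<l = <-trans i<k k<l
      i<z : i < z
      i<z = LoJump.k<pos (loJump c⋖c′ Lo-c′ ¬Lo-c)
      wz<wi : w z < w i
      wz<wi = subst (_< w i) (sym (w-pos c)) (<-≤-trans (proj₁ c⋖c′) c′≤wi)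
      z≢k : z ≢ k
      z≢k = ≢-of-w< (<-trans wz<wi (<-trans wi<wl wl<wk))
      z≢l : z ≢ l
      z≢l = ≢-of-w< (<-trans wz<wi wi<wl)
      x-i : x i ≡ w k
      x-i = trans (x-y (<⇒≢ i<k) (<⇒≢ i<l)) (trans v-i (u-x i<k))
      x-l′ : x l ≡ c′
      x-l′ = trans x-l (trans v-k u-i)
      x-above : ∀ {y} → i < y → y ≢ k → y ≢ l → x y ≡ w y
      x-above i<y y≢k y≢l = trans (x-y y≢k y≢l) (trans (v-x (λ { refl → <-irrefl i<y }) y≢k) (u-x i<y))
      x-z : x z ≡ c
      x-z = trans (x-above i<z z≢k z≢l) (w-pos c)
      clash : ∀ {p} (y : Fin n → Fin n) → In y → y p ≡ c → y i ≡ w k → y l ≡ c′ → i < p → p < k → ⊥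
      clash {p} y In-y y-p y-i y-l i<p p<k =
        hull-inversion (E-shrink Eil (<⇒≤ i<k) k<l ≤-refl) wl<wk (i , <⇒≤ i<k , <⇒≤ wi<wl)
          (subst (λ a → Hi a l) y-i (proj₂ (stepEq In-y (<-trans p<k k<l)
            (subst (_⋖ y l) (sym y-p) (subst (c ⋖_) (sym y-l) c⋖c′)) i<p
            (subst (λ a → Lo a i) (sym y-l) Lo-c′) (λ lo → ¬Lo-c (subst (λ a → Lo a i) y-p lo))
            (E-shrink Eil ≤-refl i<p (<⇒≤ (<-trans p<k k<l)))
            (k , <⇒≤ p<k , subst (_≤ w k) (sym y-i) ≤-refl))))
      finish : Dec (z < k) → ⊥
      finish (yes z<k) = clash x In-x x-z x-i x-l′ i<z z<k
      finish (no k≤z) with up In-x j<z (subst (_< x z) (sym x-j) (subst (w j <_) (sym x-z) wj<c))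
        where
        j<z : j < z
        j<z = <-≤-trans j<k k≤z
        x-j : x j ≡ w j
        x-j = x-above i<j (<⇒≢ j<k) (<⇒≢ (<-trans j<k k<l))
        wj<c : w j < c
        wj<c = ≤∧≢⇒< wj≤c λ e → <⇒≢ j<z (trans (sym (pos-w j)) (cong pos e))
      ... | y , In-y , y-j , y-z , y-x = clash y In-y (trans y-j x-z)
          (trans (y-x (<⇒≢ i<j) (<⇒≢ i<z)) x-i)
          (trans (y-x (λ e → <⇒≢ (<-trans j<k k<l) (sym e)) (λ e → z≢l (sym e))) x-l′) i<j j<k

open import Data.Fin using (_<_)

-- Sums of indicators

ind : ∀ {A : Set} → Dec A → ℕ
ind (yes _) = 1
ind (no _)  = 0

ind-mono : ∀ {A B : Set} (A? : Dec A) (B? : Dec B) → (A → B) → ind A? ℕ.≤ ind B?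
ind-mono (yes a) (yes _) _ = ℕₚ.≤-refl
ind-mono (yes a) (no ¬b) f = contradiction (f a) ¬b
ind-mono (no _)  _       _ = z≤n

ind-reflect : ∀ {A B : Set} (A? : Dec A) (B? : Dec B) → ind A? ≡ ind B? → B → A
ind-reflect (yes a) _       _ _ = a
ind-reflect (no _)  (no ¬b) _ b = contradiction b ¬b

ind-disjoint : ∀ {A B C : Set} (A? : Dec A) (B? : Dec B) (C? : Dec C) →
  (A → C) → (B → C) → (A → B → ⊥) → ind A? + ind B? ℕ.≤ ind C?
ind-disjoint (yes a) (yes b) _ _ _ d = ⊥-elim (d a b)
ind-disjoint (yes a) (no _) C? f _ _ = ind-mono (yes a) C? f
ind-disjoint (no _) B? C? _ g _ = ind-mono B? C? g

ind-cover : ∀ {A B C : Set} (C? : Dec C) (A? : Dec A) (B? : Dec B) →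
  (C → A ⊎ B) → ind C? ℕ.≤ ind A? + ind B?
ind-cover (no _)  _ _ _ = z≤n
ind-cover (yes c) (yes _) _ _ = s≤s z≤n
ind-cover (yes c) (no ¬a) (yes _) _ = ℕₚ.≤-refl
ind-cover (yes c) (no ¬a) (no ¬b) f = ⊥-elim ([ ¬a , ¬b ]′ (f c))

ind-pair-mono : ∀ {A B C D : Set} (A? : Dec A) (B? : Dec B) (C? : Dec C) (D? : Dec D) →
  (A → C ⊎ D) → (B → C ⊎ D) → (A → B → C × D) → ind A? + ind B? ℕ.≤ ind C? + ind D?
ind-pair-mono (no _)  (no _)  _       _       f g k = z≤n
ind-pair-mono (yes a) (yes b) C?      D?      f g k =
  ℕₚ.+-mono-≤ (ind-mono (yes a) C? λ _ → proj₁ (k a b)) (ind-mono (yes b) D? λ _ → proj₂ (k a b))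
ind-pair-mono (yes a) (no _)  C?      D?      f g k = ind-cover (yes a) C? D? f
ind-pair-mono (no _)  (yes b) C?      D?      f g k = ind-cover (yes b) C? D? g

ind-pair-reflect : ∀ {A B C D : Set} (A? : Dec A) (B? : Dec B) (C? : Dec C) (D? : Dec D) →
  ind A? + ind B? ≡ ind C? + ind D? → C ⊎ D → A ⊎ B
ind-pair-reflect (yes a) _       _       _       _ _  = inj₁ a
ind-pair-reflect (no _)  (yes b) _       _       _ _  = inj₂ b
ind-pair-reflect (no _)  (no _)  (no ¬c) (no ¬d) _ cd = ⊥-elim ([ ¬c , ¬d ]′ cd)

sum-mono : ∀ {n} {f g : Fin n → ℕ} → (∀ x → f x ℕ.≤ g x) → sum f ℕ.≤ sum g
sum-mono {zero}  _   = z≤n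
sum-mono {suc n} f≤g = ℕₚ.+-mono-≤ (f≤g zero) (sum-mono (f≤g ∘ suc))

+-tight : ∀ {a b c d} → a ℕ.≤ c → b ℕ.≤ d → a + b ≡ c + d → a ≡ c × b ≡ d
+-tight {a} {b} {c} {d} a≤c b≤d e = a≡c , ℕₚ.+-cancelˡ-≡ a b d (trans e (cong (_+ d) (sym a≡c)))
  where
  a≡c : a ≡ c
  a≡c = ℕₚ.≤-antisym a≤c (ℕₚ.+-cancelʳ-≤ d c a (subst (ℕ._≤ a + d) e (ℕₚ.+-monoʳ-≤ a b≤d)))

sum-tight : ∀ {n} {f g : Fin n → ℕ} → (∀ x → f x ℕ.≤ g x) → sum f ≡ sum g → f ≗ g
sum-tight {suc n} f≤g e with +-tight (f≤g zero) (sum-mono (f≤g ∘ suc)) e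
... | e₀ , e₁ = λ { zero → e₀ ; (suc x) → sum-tight (f≤g ∘ suc) e₁ x }

module _ {n : ℕ} where
  erase : Fin n → (Fin n → ℕ) → Fin n → ℕ
  erase i f k with k Finₚ.≟ i
  ... | yes _ = 0
  ... | no _  = f k

  -- Moving the mass of `j` onto `i` keeps the total and turns an inequality between pair sums into
  -- a pointwise one, so that `sum-mono` and `sum-tight` apply.
  merge : Fin n → Fin n → (Fin n → ℕ) → Fin n → ℕ
  merge i j f k with k Finₚ.≟ i
  ... | yes _ = f i + f j
  ... | no _  = erase j f k

  erase-≡ : ∀ i f → erase i f i ≡ 0
  erase-≡ i f with i Finₚ.≟ i
  ... | yes _ = refl
  ... | no i≢i = contradiction refl i≢i

  erase-≢ : ∀ {i k} f → k ≢ i → erase i f k ≡ f k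
  erase-≢ {i} {k} f k≢i with k Finₚ.≟ i
  ... | yes k≡i = contradiction k≡i k≢i
  ... | no _ = refl

  merge-≡ : ∀ i j f → merge i j f i ≡ f i + f j
  merge-≡ i j f with i Finₚ.≟ i
  ... | yes _ = refl
  ... | no i≢i = contradiction refl i≢i

  merge-≢ : ∀ {i j k} f → k ≢ i → merge i j f k ≡ erase j f k
  merge-≢ {i} {j} {k} f k≢i with k Finₚ.≟ i
  ... | yes k≡i = contradiction k≡i k≢i
  ... | no _ = refl

erase-suc : ∀ {n} (i : Fin n) f k → erase (suc i) f (suc k) ≡ erase i (f ∘ suc) k
erase-suc i f k with k Finₚ.≟ i
... | yes _ = refl
... | no _  = refl

sum-erase : ∀ {n} (i : Fin n) f → sum f ≡ f i + sum (erase i f)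
sum-erase zero f = refl
sum-erase (suc i) f = begin
  f zero + sum (f ∘ suc)                         ≡⟨ cong (f zero +_) (sum-erase i (f ∘ suc)) ⟩
  f zero + (f (suc i) + sum (erase i (f ∘ suc))) ≡⟨ x∙yz≈y∙xz (f zero) (f (suc i)) _ ⟩
  f (suc i) + (f zero + sum (erase i (f ∘ suc))) ≡⟨ cong (f (suc i) +_) (cong (f zero +_)
    (sum-cong-≗ (λ k → sym (erase-suc i f k)))) ⟩
  f (suc i) + sum (erase (suc i) f)              ∎
  where open ≡-Reasoning

module _ {n : ℕ} {i j : Fin n} (i≢j : i ≢ j) where

  sum-merge : ∀ f → sum (merge i j f) ≡ sum f
  sum-merge f = begin
    sum (merge i j f)                                 ≡⟨ sum-erase i (merge i j f) ⟩
    merge i j f i + sum (erase i (merge i j f))       ≡⟨ cong₂ _+_ (merge-≡ i j f) (sum-cong-≗ same) ⟩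
    f i + f j + sum (erase j (erase i f))             ≡⟨ ℕₚ.+-assoc (f i) (f j) _ ⟩
    f i + (f j + sum (erase j (erase i f)))           ≡⟨ cong (λ z → f i + (z + sum (erase j (erase i f)))) (erase-≢ f (i≢j ∘ sym)) ⟨
    f i + (erase i f j + sum (erase j (erase i f)))   ≡⟨ cong (f i +_) (sum-erase j (erase i f)) ⟨
    f i + sum (erase i f)                             ≡⟨ sum-erase i f ⟨
    sum f                                             ∎
    where
    open ≡-Reasoning
    same : erase i (merge i j f) ≗ erase j (erase i f)
    same k = cases (k Finₚ.≟ i) (k Finₚ.≟ j)
      where
      cases : Dec (k ≡ i) → Dec (k ≡ j) → erase i (merge i j f) k ≡ erase j (erase i f) k
      cases (yes refl) _ = trans (erase-≡ i (merge i j f)) (sym (trans (erase-≢ (erase i f) i≢j) (erase-≡ i f)))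
      cases (no k≢i) (yes refl) = trans (erase-≢ (merge i j f) k≢i)
        (trans (merge-≢ f k≢i) (trans (erase-≡ j f) (sym (erase-≡ j (erase i f)))))
      cases (no k≢i) (no k≢j) = trans (erase-≢ (merge i j f) k≢i) (trans (merge-≢ f k≢i)
        (trans (erase-≢ f k≢j) (sym (trans (erase-≢ (erase i f) k≢j) (erase-≢ f k≢i)))))

  record PairDominated (f g : Fin n → ℕ) : Set where
    field
      off  : ∀ {k} → k ≢ i → k ≢ j → f k ℕ.≤ g k
      pair : f i + f j ℕ.≤ g i + g j

    merge-≤ : ∀ k → merge i j f k ℕ.≤ merge i j g k
    merge-≤ k with k Finₚ.≟ i
    ... | yes _ = pair
    ... | no k≢i with k Finₚ.≟ j
    ...   | yes _ = z≤n
    ...   | no k≢j = off k≢i k≢j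

    sum-≤ : sum f ℕ.≤ sum g
    sum-≤ = subst₂ ℕ._≤_ (sum-merge f) (sum-merge g) (sum-mono merge-≤)

    merge-tight : sum f ≡ sum g → merge i j f ≗ merge i j g
    merge-tight e = sum-tight merge-≤ (trans (sum-merge f) (trans e (sym (sum-merge g))))

    pair-tight : sum f ≡ sum g → f i + f j ≡ g i + g j
    pair-tight e = trans (sym (merge-≡ i j f)) (trans (merge-tight e i) (merge-≡ i j g))

    off-tight : sum f ≡ sum g → ∀ {k} → k ≢ i → k ≢ j → f k ≡ g k
    off-tight e {k} k≢i k≢j = trans (sym (at f)) (trans (merge-tight e k) (at g))
      where
      at : ∀ f → merge i j f k ≡ f k
      at f = trans (merge-≢ f k≢i) (erase-≢ f k≢j)

  -- Fitted to a swap of the positions `i` and `j`: entries in the two rows and columns are compared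
  -- only in pairs, and the common block only as a whole. It serves both for inversions and for hull
  -- edges.
  record PairDominated² (f g : Fin n → Fin n → ℕ) : Set where
    field
      off : ∀ {x y} → x ≢ i → x ≢ j → y ≢ i → y ≢ j → f x y ℕ.≤ g x y
      col : ∀ {x} → x ≢ i → x ≢ j → f x i + f x j ℕ.≤ g x i + g x j
      row : ∀ {y} → y ≢ i → y ≢ j → f i y + f j y ℕ.≤ g i y + g j y
      blk : f i i + f j i + (f i j + f j j) ℕ.≤ g i i + g j i + (g i j + g j j)

    private
      rows : ∀ {x} → x ≢ i → x ≢ j → PairDominated (f x) (g x)
      rows x≢i x≢j = record { off = off x≢i x≢j ; pair = col x≢i x≢j }

      tworows : PairDominated (λ y → f i y + f j y) (λ y → g i y + g j y)
      tworows = record { off = row ; pair = blk }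

      outer : PairDominated (λ x → sum (f x)) (λ x → sum (g x))
      outer = record
        { off  = λ x≢i x≢j → PairDominated.sum-≤ (rows x≢i x≢j)
        ; pair = subst₂ ℕ._≤_ (∑-distrib-+ (f i) (f j)) (∑-distrib-+ (g i) (g j)) (PairDominated.sum-≤ tworows)
        }

    sum²-≤ : sum (λ x → sum (f x)) ℕ.≤ sum (λ x → sum (g x))
    sum²-≤ = PairDominated.sum-≤ outer

    module _ (e : sum (λ x → sum (f x)) ≡ sum (λ x → sum (g x))) where
      col-tight : ∀ {x} → x ≢ i → x ≢ j → f x i + f x j ≡ g x i + g x j
      col-tight x≢i x≢j = PairDominated.pair-tight (rows x≢i x≢j) (PairDominated.off-tight outer e x≢i x≢j)

      private
        tworows-≡ : sum (λ y → f i y + f j y) ≡ sum (λ y → g i y + g j y)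
        tworows-≡ = trans (∑-distrib-+ (f i) (f j))
          (trans (PairDominated.pair-tight outer e) (sym (∑-distrib-+ (g i) (g j))))

      row-tight : ∀ {y} → y ≢ i → y ≢ j → f i y + f j y ≡ g i y + g j y
      row-tight = PairDominated.off-tight tworows tworows-≡

      blk-tight : f i i + f j i + (f i j + f j j) ≡ g i i + g j i + (g i j + g j j)
      blk-tight = PairDominated.pair-tight tworows tworows-≡

-- Counting by lists

length-filter-++ : ∀ {A : Set} {P : A → Set} (P? : Decidable P) xs ys →
  length (filter P? (xs ++ ys)) ≡ length (filter P? xs) + length (filter P? ys)
length-filter-++ P? xs ys = trans (cong length (Listₚ.filter-++ P? xs ys)) (Listₚ.length-++ (filter P? xs))

length-filter-tabulate : ∀ {A : Set} {P : A → Set} (P? : Decidable P) {n} (f : Fin n → A) →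
  length (filter P? (tabulate f)) ≡ sum (λ k → ind (P? (f k)))
length-filter-tabulate P? {zero} f = refl
length-filter-tabulate P? {suc n} f with P? (f zero)
... | yes _ = cong suc (length-filter-tabulate P? (f ∘ suc))
... | no _  = length-filter-tabulate P? (f ∘ suc)

pairs : ∀ n → List (Fin n × Fin n)
pairs n = cartesianProduct (allFin n) (allFin n)

length-filter-pairs : ∀ {n} {P : Fin n × Fin n → Set} (P? : Decidable P) →
  length (filter P? (pairs n)) ≡ sum (λ x → sum (λ y → ind (P? (x , y))))
length-filter-pairs {n} P? = go id
  where
  go : ∀ {m} (f : Fin m → Fin n) →
    length (filter P? (cartesianProduct (tabulate f) (allFin n))) ≡ sum (λ x → sum (λ y → ind (P? (f x , y))))
  go {zero}  f = refl
  go {suc m} f = trans (length-filter-++ P? (map (f zero ,_) (allFin n)) _)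
    (cong₂ _+_ (trans (cong (length ∘ filter P?) (Listₚ.map-tabulate id (f zero ,_)))
                      (length-filter-tabulate P? (f zero ,_)))
               (go (f ∘ suc)))

module _ {A B : Set} {_≈_ : A → A → Set} {_∼_ : A → B → Set}
  (inj : ∀ {a a′ b} → a ∼ b → a′ ∼ b → a ≈ a′) where

  remove : ∀ {a ys} → Any (a ∼_) ys → ∃ λ zs → length ys ≡ suc (length zs) ×
    (∀ {a′} → ¬ (a ≈ a′) → Any (a′ ∼_) ys → Any (a′ ∼_) zs)
  remove {ys = y ∷ ys} (here a∼y) = ys , refl , λ
    { a≉a′ (here a′∼y) → contradiction (inj a∼y a′∼y) a≉a′ ; _ (there p) → p }
  remove {ys = y ∷ ys} (there p) with remove p
  ... | zs , len , keep = y ∷ zs , cong suc len , λ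
    { _ (here q) → here q ; a≉a′ (there q) → there (keep a≉a′ q) }

  -- A pigeonhole principle with a relation in place of a map: each match uses up one entry of `ys`.
  -- It is needed with `≗` on one-line notations as well as with equality of index pairs.
  length-≤ : ∀ {xs ys} → AllPairs (λ a b → ¬ (a ≈ b)) xs → All (λ a → Any (a ∼_) ys) xs →
    length xs ℕ.≤ length ys
  length-≤ [] [] = z≤n
  length-≤ {ys = ys} (a≉ ∷ distinct) (p ∷ ps) with remove p
  ... | zs , len , keep = subst (_ ℕ.≤_) (sym len)
    (s≤s (length-≤ distinct (All.zipWith (λ (a≉a′ , q) → keep a≉a′ q) (a≉ , ps))))

-- Swaps, bijections and inversions

module _ {n : ℕ} where

  -- A relational form, since one-line notations are compared only pointwise; it also makes
  -- reversing a swap immediate.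
  record IsSwap (u : OneLine n) (i j : Fin n) (v : OneLine n) : Set where
    constructor isSwap
    field
      at-i  : v i ≡ u j
      at-j  : v j ≡ u i
      other : ∀ {k} → k ≢ i → k ≢ j → v k ≡ u k

  swapPos-isSwap : ∀ u i j → IsSwap u i j (swapPos u i j)
  swapPos-isSwap u i j = isSwap (cong u at-i) (cong u at-j) (λ k≢i k≢j → cong u (other k≢i k≢j))
    where
    at-i : transpose i j i ≡ j
    at-i with i Finₚ.≟ i
    ... | yes _ = refl
    ... | no i≢i = contradiction refl i≢i
    at-j : transpose i j j ≡ i
    at-j with j Finₚ.≟ i
    ... | yes j≡i = j≡i
    ... | no _ with j Finₚ.≟ j
    ...   | yes _ = refl
    ...   | no j≢j = contradiction refl j≢j
    other : ∀ {k} → k ≢ i → k ≢ j → transpose i j k ≡ k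
    other {k} k≢i k≢j with k Finₚ.≟ i
    ... | yes k≡i = contradiction k≡i k≢i
    ... | no _ with k Finₚ.≟ j
    ...   | yes k≡j = contradiction k≡j k≢j
    ...   | no _ = refl

  isSwap-≗ : ∀ {u i j v v′} → v ≗ v′ → IsSwap u i j v′ → IsSwap u i j v
  isSwap-≗ e (isSwap p q r) = isSwap (trans (e _) p) (trans (e _) q) (λ a b → trans (e _) (r a b))

  isSwap⇒≗ : ∀ {u i j v} → IsSwap u i j v → v ≗ swapPos u i j
  isSwap⇒≗ {u} {i} {j} {v} (isSwap p q r) k = cases (k Finₚ.≟ i) (k Finₚ.≟ j)
    where
    open IsSwap (swapPos-isSwap u i j)
    cases : Dec (k ≡ i) → Dec (k ≡ j) → v k ≡ swapPos u i j k
    cases (yes refl) _          = trans p (sym at-i)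
    cases (no _)     (yes refl) = trans q (sym at-j)
    cases (no k≢i)   (no k≢j)   = trans (r k≢i k≢j) (sym (other k≢i k≢j))

  isSwap-reverse : ∀ {u i j v} → IsSwap u i j v → IsSwap v i j u
  isSwap-reverse (isSwap p q r) = isSwap (sym q) (sym p) (λ a b → sym (r a b))

  record Bij (u : OneLine n) : Set where
    field
      injective : ∀ {x y} → u x ≡ u y → x ≡ y
      pos       : Fin n → Fin n
      u-pos     : ∀ a → u (pos a) ≡ a

    pos-u : ∀ x → pos (u x) ≡ x
    pos-u x = injective (u-pos (u x))

  bij-swap : ∀ {u i j v} → Bij u → IsSwap u i j v → Bij v
  bij-swap {u} {i} {j} {v} B s = record
    { injective = λ {x} {y} e → trans (sym (ττ x)) (trans (cong τ (injective (trans (sym (v≗ x)) (trans e (v≗ y))))) (ττ y))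
    ; pos = τ ∘ pos
    ; u-pos = λ a → trans (v≗ (τ (pos a))) (trans (cong u (ττ (pos a))) (u-pos a))
    }
    where
    open Bij B
    τ : Fin n → Fin n
    τ = transpose i j
    v≗ : v ≗ u ∘ τ
    v≗ = isSwap⇒≗ s
    ττ : ∀ x → τ (τ x) ≡ x
    ττ x = cases (x Finₚ.≟ i) (x Finₚ.≟ j)
      where
      open IsSwap (swapPos-isSwap id i j)
      cases : Dec (x ≡ i) → Dec (x ≡ j) → τ (τ x) ≡ x
      cases (yes refl) _          = trans (cong τ at-i) at-j
      cases (no _)     (yes refl) = trans (cong τ at-j) at-i
      cases (no x≢i)   (no x≢j)   = trans (cong τ (other x≢i x≢j)) (other x≢i x≢j)

  inv-sum : ∀ (u : OneLine n) → inv u ≡ sum (λ x → sum (λ y → ind ((x Finₚ.<? y) ×-dec (u y Finₚ.<? u x))))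
  inv-sum u = length-filter-pairs {P = λ (x , y) → x < y × u y < u x} (λ (x , y) → (x Finₚ.<? y) ×-dec (u y Finₚ.<? u x))

  -- With a third position, one inversion may be lost while its partner is gained, so these are
  -- counted in pairs. The pair (i , j) itself makes the increase strict.
  inv-increase : ∀ {u v : OneLine n} {i j} → i < j → u i < u j → IsSwap u i j v → inv u ℕ.< inv v
  inv-increase {u} {v} {i} {j} i<j ui<uj (isSwap v-i v-j v-k) =
    subst₂ ℕ._<_ (sym (inv-sum u)) (sym (inv-sum v))
      (ℕₚ.≤∧≢⇒< sum²-≤ λ e → contradiction (blk-tight e) blk≢)
    where
    i≢j : i ≢ j
    i≢j refl = ℕₚ.<-irrefl refl i<j
    I : OneLine n → Fin n → Fin n → ℕ
    I u x y = ind ((x Finₚ.<? y) ×-dec (u y Finₚ.<? u x))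
    off : ∀ {x y} → x ≢ i → x ≢ j → y ≢ i → y ≢ j → I u x y ℕ.≤ I v x y
    off x≢i x≢j y≢i y≢j rewrite v-k x≢i x≢j | v-k y≢i y≢j = ℕₚ.≤-refl
    col : ∀ {x} → x ≢ i → x ≢ j → I u x i + I u x j ℕ.≤ I v x i + I v x j
    col {x} x≢i x≢j rewrite v-k x≢i x≢j | v-i | v-j =
      ind-pair-mono (x Finₚ.<? i ×-dec u i Finₚ.<? u x) (x Finₚ.<? j ×-dec u j Finₚ.<? u x)
                    (x Finₚ.<? i ×-dec u j Finₚ.<? u x) (x Finₚ.<? j ×-dec u i Finₚ.<? u x)
        (λ (p , q) → inj₂ (ℕₚ.<-trans p i<j , q)) (λ (p , q) → inj₂ (p , ℕₚ.<-trans ui<uj q))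
        (λ (p , q) (p′ , q′) → (p , q′) , (p′ , q))
    row : ∀ {y} → y ≢ i → y ≢ j → I u i y + I u j y ℕ.≤ I v i y + I v j y
    row {y} y≢i y≢j rewrite v-k y≢i y≢j | v-i | v-j =
      ind-pair-mono (i Finₚ.<? y ×-dec u y Finₚ.<? u i) (j Finₚ.<? y ×-dec u y Finₚ.<? u j)
                    (i Finₚ.<? y ×-dec u y Finₚ.<? u j) (j Finₚ.<? y ×-dec u y Finₚ.<? u i)
        (λ (p , q) → inj₁ (p , ℕₚ.<-trans q ui<uj)) (λ (p , q) → inj₁ (ℕₚ.<-trans i<j p , q))
        (λ (p , q) (p′ , q′) → (p , q′) , (p′ , q))
    zero-I : ∀ (u : OneLine n) {x y} → ¬ (x < y × u y < u x) → I u x y ≡ 0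
    zero-I u {x} {y} ¬p with (x Finₚ.<? y) ×-dec (u y Finₚ.<? u x)
    ... | yes p = contradiction p ¬p
    ... | no _ = refl
    one-I : I v i j ≡ 1
    one-I with (i Finₚ.<? j) ×-dec (v j Finₚ.<? v i)
    ... | yes _ = refl
    ... | no ¬p = contradiction (i<j , subst₂ _<_ (sym v-j) (sym v-i) ui<uj) ¬p
    blk-u : I u i i + I u j i + (I u i j + I u j j) ≡ 0
    blk-u = cong₂ _+_
      (cong₂ _+_ (zero-I u {i} {i} (ℕₚ.<-irrefl refl ∘ proj₁)) (zero-I u {j} {i} (ℕₚ.<-asym i<j ∘ proj₁)))
      (cong₂ _+_ (zero-I u {i} {j} (ℕₚ.<-asym ui<uj ∘ proj₂)) (zero-I u {j} {j} (ℕₚ.<-irrefl refl ∘ proj₁)))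
    blk≢ : ¬ (I u i i + I u j i + (I u i j + I u j j) ≡ I v i i + I v j i + (I v i j + I v j j))
    blk≢ e with trans (sym blk-u) (trans e (cong (λ z → I v i i + I v j i + (z + I v j j)) one-I))
    ... | e′ rewrite ℕₚ.+-suc (I v i i + I v j i) (I v j j) with () ← e′
    dominated : PairDominated² i≢j (I u) (I v)
    dominated = record { off = off ; col = col ; row = row ; blk = ℕₚ.≤-trans (ℕₚ.≤-reflexive blk-u) z≤n }
    open PairDominated² dominated using (sum²-≤; blk-tight)

  inv-bound : ∀ (u : OneLine n) → inv u ℕ.≤ length (pairs n)
  inv-bound u = Listₚ.length-filter _ (pairs n)

-- The rank criterion for the Bruhat order

least : ∀ {n} {P : Fin n → Set} → Decidable P → ∃ P → ∃ λ x → P x × (∀ {y} → y < x → ¬ P y)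
least {suc n} {P} P? (x , Px) with P? zero
... | yes P₀ = zero , P₀ , λ ()
... | no ¬P₀ with x
...   | zero = contradiction Px ¬P₀
...   | suc x′ with least (P? ∘ suc) (x′ , Px)
...     | z , Pz , min = suc z , Pz , below
  where
  below : ∀ {y} → y < suc z → ¬ P y
  below {zero}  _         = ¬P₀
  below {suc y} (s≤s y<z) = min y<z

crossℕ : ∀ {P : ℕ → Set} → Decidable P → ∀ {a b} → a ℕ.≤ b → ¬ P a → P b →
  ∃ λ c → a ℕ.≤ c × c ℕ.< b × ¬ P c × P (suc c)
crossℕ P? {a} {b} a≤b ¬Pa Pb with ℕₚ.m≤n⇒m<n∨m≡n a≤b
... | inj₂ refl = contradiction Pb ¬Pa
crossℕ P? {a} {suc b} _ ¬Pa Pb | inj₁ (s≤s a≤b) with P? b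
... | no ¬Pb = b , a≤b , ℕₚ.≤-refl , ¬Pb , Pb
... | yes Pb′ with crossℕ P? a≤b ¬Pa Pb′
...   | c , a≤c , c<b , r = c , a≤c , ℕₚ.m≤n⇒m≤1+n c<b , r

crossFin : ∀ {n} {P : Fin n → Set} → Decidable P → ∀ {a b} → a < b → ¬ P a → P b →
  ∃₂ λ c c′ → a Fin.≤ c × toℕ c′ ≡ suc (toℕ c) × c′ Fin.≤ b × ¬ P c × P c′
crossFin {n} {P} P? {a} {b} a<b ¬Pa Pb
  with crossℕ {P = λ k → ∃ λ x → toℕ x ≡ k × P x} (λ k → Finₚ.any? λ x → (toℕ x ℕ.≟ k) ×-dec P? x)
         (ℕₚ.<⇒≤ a<b) (λ { (x , x≡a , Px) → ¬Pa (subst P (Finₚ.toℕ-injective x≡a) Px) }) (b , refl , Pb)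
... | k , a≤k , k<b , ¬Pk , (c′ , c′≡ , Pc′) =
  fromℕ< k<n , c′ , subst (toℕ a ℕ.≤_) (sym k≡) a≤k , trans c′≡ (cong suc (sym k≡)) ,
  subst (ℕ._≤ toℕ b) (sym c′≡) k<b , (λ Pc → ¬Pk (fromℕ< k<n , k≡ , Pc)) , Pc′
  where
  k<n : k ℕ.< n
  k<n = ℕₚ.<-trans k<b (Finₚ.toℕ<n b)
  k≡ : toℕ (fromℕ< k<n) ≡ k
  k≡ = Finₚ.toℕ-fromℕ< k<n

sum-except : ∀ {n} (x : Fin n) {f g : Fin n → ℕ} → (∀ {k} → k ≢ x → f k ≡ g k) →
  sum f + g x ≡ sum g + f x
sum-except x {f} {g} f≡g = begin
  sum f + g x                     ≡⟨ cong (_+ g x) (sum-erase x f) ⟩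
  f x + sum (erase x f) + g x     ≡⟨ cong (λ z → f x + z + g x) (sum-cong-≗ same) ⟩
  f x + sum (erase x g) + g x     ≡⟨ ℕₚ.+-comm (f x + sum (erase x g)) (g x) ⟩
  g x + (f x + sum (erase x g))   ≡⟨ cong (g x +_) (ℕₚ.+-comm (f x) _) ⟩
  g x + (sum (erase x g) + f x)   ≡⟨ ℕₚ.+-assoc (g x) _ (f x) ⟨
  g x + sum (erase x g) + f x     ≡⟨ cong (_+ f x) (sum-erase x g) ⟨
  sum g + f x                     ∎
  where
  open ≡-Reasoning
  same : erase x f ≗ erase x g
  same k with k Finₚ.≟ x
  ... | yes _ = refl
  ... | no k≢x = f≡g k≢x

ind-cong : ∀ {A B : Set} (A? : Dec A) (B? : Dec B) → (A → B) → (B → A) → ind A? ≡ ind B?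
ind-cong A? B? f g = ℕₚ.≤-antisym (ind-mono A? B? f) (ind-mono B? A? g)

ind-no : ∀ {A : Set} (A? : Dec A) → ¬ A → ind A? ≡ 0
ind-no (yes a) ¬a = contradiction a ¬a
ind-no (no _)  _  = refl

sum-single : ∀ {n} {f g : Fin n → ℕ} (x y : Fin n) → (∀ {k} → k ≢ x → f k ≡ 0) → f x ℕ.≤ g y →
  sum f ℕ.≤ sum g
sum-single {f = f} {g} x y f≡0 fx≤gy = begin
  sum f                 ≡⟨ sum-erase x f ⟩
  f x + sum (erase x f) ≡⟨ cong (f x +_) (sum-zero (erase x f) vanish) ⟩
  f x + 0               ≤⟨ ℕₚ.+-mono-≤ fx≤gy z≤n ⟩
  g y + sum (erase y g) ≡⟨ sum-erase y g ⟨
  sum g                 ∎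
  where
  open ℕₚ.≤-Reasoning
  sum-zero : ∀ {n} (f : Fin n → ℕ) → (∀ k → f k ≡ 0) → sum f ≡ 0
  sum-zero {zero}  f _ = refl
  sum-zero {suc n} f z = cong₂ _+_ (z zero) (sum-zero (f ∘ suc) (z ∘ suc))
  vanish : ∀ k → erase x f k ≡ 0
  vanish k with k Finₚ.≟ x
  ... | yes _ = refl
  ... | no k≢x = f≡0 k≢x

module _ {n : ℕ} where

  private variable u v w : OneLine n

  -- m and a are natural numbers so as to include the boundary cases m = n and a = n.
  inCorner? : ∀ (u : OneLine n) m a x → Dec (toℕ x ℕ.< m × a ℕ.≤ toℕ (u x))
  inCorner? u m a x = (toℕ x ℕ.<? m) ×-dec (a ℕ.≤? toℕ (u x))

  rk : OneLine n → ℕ → ℕ → ℕ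
  rk u m a = sum (λ x → ind (inCorner? u m a x))

  _⊑_ : OneLine n → OneLine n → Set
  w ⊑ u = ∀ m a → rk w m a ℕ.≤ rk u m a

  rk-mono : ∀ {m m′ a a′} → (∀ {x} → toℕ x ℕ.< m → a ℕ.≤ toℕ (u x) → toℕ x ℕ.< m′ × a′ ℕ.≤ toℕ (v x)) →
    rk u m a ℕ.≤ rk v m′ a′
  rk-mono {u} {v} {m} {m′} {a} {a′} f =
    sum-mono λ x → ind-mono (inCorner? u m a x) (inCorner? v m′ a′ x) λ (p , q) → f p q

  rk-sucˡ : ∀ u (x : Fin n) a → rk u (suc (toℕ x)) a ≡ rk u (toℕ x) a + ind (a ℕ.≤? toℕ (u x))
  rk-sucˡ u x a = begin
    rk u (suc (toℕ x)) a
      ≡⟨ ℕₚ.+-identityʳ _ ⟨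
    rk u (suc (toℕ x)) a + 0
      ≡⟨ cong (rk u (suc (toℕ x)) a +_) (ind-no (inCorner? u (toℕ x) a x) (ℕₚ.<-irrefl refl ∘ proj₁)) ⟨
    rk u (suc (toℕ x)) a + ind (inCorner? u (toℕ x) a x)
      ≡⟨ sum-except x (λ {k} k≢x → ind-cong (inCorner? u (suc (toℕ x)) a k) (inCorner? u (toℕ x) a k)
           (λ (p , q) → ℕₚ.≤∧≢⇒< (ℕₚ.≤-pred p) (k≢x ∘ Finₚ.toℕ-injective) , q)
           (λ (p , q) → ℕₚ.m≤n⇒m≤1+n p , q)) ⟩
    rk u (toℕ x) a + ind (inCorner? u (suc (toℕ x)) a x)
      ≡⟨ cong (rk u (toℕ x) a +_) (ind-cong (inCorner? u (suc (toℕ x)) a x) (a ℕ.≤? toℕ (u x)) proj₂ (ℕₚ.≤-refl ,_)) ⟩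
    rk u (toℕ x) a + ind (a ℕ.≤? toℕ (u x)) ∎
    where open ≡-Reasoning

  rk-sucʳ : (B : Bij u) → let open Bij B in ∀ m (y : Fin n) →
    rk u m (toℕ y) ≡ rk u m (suc (toℕ y)) + ind (toℕ (pos y) ℕ.<? m)
  rk-sucʳ {u} B m y = begin
    rk u m (toℕ y)
      ≡⟨ ℕₚ.+-identityʳ _ ⟨
    rk u m (toℕ y) + 0
      ≡⟨ cong (rk u m (toℕ y) +_) (ind-no (inCorner? u m (suc (toℕ y)) (pos y))
           (λ (_ , q) → ℕₚ.<-irrefl (cong toℕ (sym (u-pos y))) q)) ⟨
    rk u m (toℕ y) + ind (inCorner? u m (suc (toℕ y)) (pos y))
      ≡⟨ sum-except (pos y) (λ {k} k≢ → ind-cong (inCorner? u m (toℕ y) k) (inCorner? u m (suc (toℕ y)) k)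
           (λ (p , q) → p , ℕₚ.≤∧≢⇒< q (λ e → k≢ (injective (trans (sym (Finₚ.toℕ-injective e)) (sym (u-pos y))))))
           (λ (p , q) → p , ℕₚ.<⇒≤ q)) ⟩
    rk u m (suc (toℕ y)) + ind (inCorner? u m (toℕ y) (pos y))
      ≡⟨ cong (rk u m (suc (toℕ y)) +_) (ind-cong (inCorner? u m (toℕ y) (pos y)) (toℕ (pos y) ℕ.<? m) proj₁
           (λ p → p , ℕₚ.≤-reflexive (cong toℕ (sym (u-pos y))))) ⟩
    rk u m (suc (toℕ y)) + ind (toℕ (pos y) ℕ.<? m) ∎
    where
    open ≡-Reasoning
    open Bij B

  rk-total : Bij u → ∀ a → rk u n a ≡ sum (λ y → ind (a ℕ.≤? toℕ {n} y))
  rk-total {u} B a = begin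
    rk u n a                              ≡⟨ sum-cong-≗ (λ x → ind-cong (inCorner? u n a x) (a ℕ.≤? toℕ (u x)) proj₂ (Finₚ.toℕ<n x ,_)) ⟩
    sum (λ x → ind (a ℕ.≤? toℕ (u x)))    ≡⟨ sum-permute _ (permutation u pos u-pos pos-u) ⟨
    sum (λ y → ind (a ℕ.≤? toℕ {n} y))    ∎
    where
    open ≡-Reasoning
    open Bij B

  rk-total-≡ : Bij u → Bij v → ∀ a → rk u n a ≡ rk v n a
  rk-total-≡ B B′ a = trans (rk-total B a) (sym (rk-total B′ a))

  -- Below p the permutations agree; exchanging w p with the first later value in
  -- (w p , u p] keeps w below u, since the added dot is matched by the dot (p , u p).
  rank-step : Bij w → Bij u → w ⊑ u → ¬ (w ≗ u) →
    ∃ λ p → ∃ λ q → p < q × w p < w q × swapPos w p q ⊑ u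
  rank-step {w} {u} Bw Bu w⊑u w≢u
    with least (λ x → ¬? (w x Finₚ.≟ u x)) (Finₚ.¬∀⟶∃¬ n _ (λ x → w x Finₚ.≟ u x) w≢u)
  ... | p , wp≢up , agree = found (least {P = Between} between? exists)
    where
    same : ∀ {x} → x < p → w x ≡ u x
    same {x} x<p = decidable-stable (w x Finₚ.≟ u x) (agree x<p)
    -- If `u p` were smaller, then at the corner (p + 1, w p) the dots of `u` would be among those
    -- of `w`. With `w ⊑ u` the two sets coincide, but `w` has a dot at `p` and `u` does not.
    wp<up : w p < u p
    wp<up with Finₚ.<-cmp (w p) (u p)
    ... | tri< lt _ _ = lt
    ... | tri≈ _ eq _ = contradiction eq wp≢up
    ... | tri> _ _ up<wp = contradiction
      (ind-reflect (inCorner? u (suc (toℕ p)) (toℕ (w p)) p) (inCorner? w (suc (toℕ p)) (toℕ (w p)) p)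
        (sum-tight dominated (ℕₚ.≤-antisym (sum-mono dominated) (w⊑u (suc (toℕ p)) (toℕ (w p)))) p)
        (ℕₚ.≤-refl , ℕₚ.≤-refl))
      (λ (_ , wp≤up) → ℕₚ.<-irrefl refl (ℕₚ.<-≤-trans up<wp wp≤up))
      where
      dominated : ∀ x → ind (inCorner? u (suc (toℕ p)) (toℕ (w p)) x) ℕ.≤ ind (inCorner? w (suc (toℕ p)) (toℕ (w p)) x)
      dominated x = ind-mono (inCorner? u (suc (toℕ p)) (toℕ (w p)) x) (inCorner? w (suc (toℕ p)) (toℕ (w p)) x) λ (x≤p , wp≤ux) →
        x≤p , [ (λ x<p → subst (λ z → toℕ (w p) ℕ.≤ toℕ z) (sym (same x<p)) wp≤ux)
              , (λ x≡p → ℕₚ.≤-reflexive (cong (toℕ ∘ w) (sym (Finₚ.toℕ-injective x≡p)))) ]′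
              (ℕₚ.m≤n⇒m<n∨m≡n (ℕₚ.≤-pred x≤p))
    Between : Fin n → Set
    Between q = p < q × w p < w q × w q Fin.≤ u p
    between? : Decidable Between
    between? q = (p Finₚ.<? q) ×-dec ((w p Finₚ.<? w q) ×-dec (w q Finₚ.≤? u p))
    exists : ∃ Between
    exists = y , p<y , subst (w p <_) (sym wy≡up) wp<up , ℕₚ.≤-reflexive (cong toℕ wy≡up)
      where
      y : Fin n
      y = Bij.pos Bw (u p)
      wy≡up : w y ≡ u p
      wy≡up = Bij.u-pos Bw (u p)
      p<y : p < y
      p<y with Finₚ.<-cmp p y
      ... | tri< lt _ _ = lt
      ... | tri≈ _ eq _ = contradiction (trans (cong w eq) wy≡up) wp≢up
      ... | tri> _ _ y<p = contradiction (cong toℕ (Bij.injective Bu (trans (sym (same y<p)) wy≡up))) (ℕₚ.<⇒≢ y<p)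
    found : (∃ λ q → Between q × (∀ {y} → y < q → ¬ Between y)) →
      ∃ λ p → ∃ λ q → p < q × w p < w q × swapPos w p q ⊑ u
    found (q , (p<q , wp<wq , wq≤up) , first) = p , q , p<q , wp<wq , below
      where
      open IsSwap (swapPos-isSwap w p q)
      w′ : OneLine n
      w′ = swapPos w p q
      p≢q : p ≢ q
      p≢q p≡q = ℕₚ.<⇒≢ p<q (cong toℕ p≡q)
      below : w′ ⊑ u
      below m a with (toℕ p ℕ.<? m) ×-dec ((m ℕ.≤? toℕ q) ×-dec ((toℕ (w p) ℕ.<? a) ×-dec (a ℕ.≤? toℕ (w q))))
      ... | yes (p<m , m≤q , wp<a , a≤wq) = begin
        rk w′ m a                ≤⟨ sum-mono split-v ⟩
        sum (λ x → ind (inCorner? w m b x) + ind (extra? x))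
                                ≡⟨ ∑-distrib-+ (λ x → ind (inCorner? w m b x)) (ind ∘ extra?) ⟩
        rk w m b + sum (ind ∘ extra?)
                                ≤⟨ ℕₚ.+-monoˡ-≤ _ (w⊑u m b) ⟩
        rk u m b + sum (ind ∘ extra?)
                                ≡⟨ ∑-distrib-+ (λ x → ind (inCorner? u m b x)) (ind ∘ extra?) ⟨
        sum (λ x → ind (inCorner? u m b x) + ind (extra? x))
                                ≤⟨ sum-mono join-u ⟩
        rk u m a                ∎
        where
        open ℕₚ.≤-Reasoning
        -- The rank condition is used just above `u p`: by the choice of `q`, entries of `w`
        -- strictly between `p` and `m` that reach `a` also reach `b`. The dots still missing stand
        -- at positions up to `p` and are counted by `extra?`.
        b : ℕ
        b = suc (toℕ (u p))
        extra? : ∀ x → Dec (x Fin.≤ p × a ℕ.≤ toℕ (u x) × toℕ (u x) ℕ.< b)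
        extra? x = (x Finₚ.≤? p) ×-dec ((a ℕ.≤? toℕ (u x)) ×-dec (toℕ (u x) ℕ.<? b))
        join-u : ∀ x → ind (inCorner? u m b x) + ind (extra? x) ℕ.≤ ind (inCorner? u m a x)
        join-u x = ind-disjoint (inCorner? u m b x) (extra? x) (inCorner? u m a x)
          (λ (x<m , b≤ux) → x<m , ℕₚ.≤-trans a≤wq (ℕₚ.≤-trans wq≤up (ℕₚ.<⇒≤ b≤ux)))
          (λ (x≤p , a≤ux , _) → ℕₚ.≤-<-trans x≤p p<m , a≤ux)
          (λ (_ , b≤ux) (_ , _ , ux<b) → ℕₚ.<-irrefl refl (ℕₚ.<-≤-trans ux<b b≤ux))
        cover : ∀ {x} → toℕ x ℕ.< m → a ℕ.≤ toℕ (w′ x) →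
          (toℕ x ℕ.< m × b ℕ.≤ toℕ (w x)) ⊎ (x Fin.≤ p × a ℕ.≤ toℕ (u x) × toℕ (u x) ℕ.< b)
        cover {x} x<m a≤vx with Finₚ.<-cmp x p
        ... | tri≈ _ refl _ = inj₂ (ℕₚ.≤-refl , ℕₚ.≤-trans a≤wq wq≤up , ℕₚ.≤-refl)
        ... | tri< x<p x≢p _ with b ℕ.≤? toℕ (w x)
        ...   | yes b≤wx = inj₁ (x<m , b≤wx)
        ...   | no b≰wx = inj₂ (ℕₚ.<⇒≤ x<p , subst (λ z → a ℕ.≤ toℕ z) w′x≡ux a≤vx ,
                  subst (λ z → toℕ z ℕ.< b) (same x<p) (ℕₚ.≰⇒> b≰wx))
          where
          w′x≡ux : w′ x ≡ u x
          w′x≡ux = trans (other x≢p (λ x≡q → ℕₚ.<⇒≢ (ℕₚ.<-trans x<p p<q) (cong toℕ x≡q))) (same x<p)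
        cover {x} x<m a≤vx | tri> _ x≢p p<x = inj₁ (x<m , ℕₚ.≰⇒> λ wx≤up →
          first x<q (p<x , ℕₚ.<-≤-trans wp<a (subst (λ z → a ℕ.≤ toℕ z) (other x≢p x≢q) a≤vx) , wx≤up))
          where
          x<q : x < q
          x<q = ℕₚ.<-≤-trans x<m m≤q
          x≢q : x ≢ q
          x≢q x≡q = ℕₚ.<⇒≢ x<q (cong toℕ x≡q)
        split-v : ∀ x → ind (inCorner? w′ m a x) ℕ.≤ ind (inCorner? w m b x) + ind (extra? x)
        split-v x = ind-cover (inCorner? w′ m a x) (inCorner? w m b x) (extra? x) λ (x<m , a≤vx) → cover x<m a≤vx
      ... | no outside = ℕₚ.≤-trans (PairDominated.sum-≤ dominated) (w⊑u m a)
        where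
        dominated : PairDominated p≢q (λ x → ind (inCorner? w′ m a x)) (λ x → ind (inCorner? w m a x))
        dominated = record
          { off  = λ {k} k≢p k≢q → ind-mono (inCorner? w′ m a k) (inCorner? w m a k)
              λ (k<m , a≤vk) → k<m , subst (λ z → a ℕ.≤ toℕ z) (other k≢p k≢q) a≤vk
          ; pair = ind-pair-mono (inCorner? w′ m a p) (inCorner? w′ m a q) (inCorner? w m a p) (inCorner? w m a q)
              (λ (p<m , a≤vp) → at-p p<m (subst (λ z → a ℕ.≤ toℕ z) at-i a≤vp))
              (λ (q<m , a≤vq) → inj₁ (ℕₚ.<-trans p<q q<m , subst (λ z → a ℕ.≤ toℕ z) at-j a≤vq))
              (λ (p<m , a≤vp) (q<m , a≤vq) →
                (p<m , subst (λ z → a ℕ.≤ toℕ z) at-j a≤vq) , (q<m , subst (λ z → a ℕ.≤ toℕ z) at-i a≤vp))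
          }
          where
          at-p : toℕ p ℕ.< m → a ℕ.≤ toℕ (w q) →
            (toℕ p ℕ.< m × a ℕ.≤ toℕ (w p)) ⊎ (toℕ q ℕ.< m × a ℕ.≤ toℕ (w q))
          at-p p<m a≤wq with toℕ q ℕ.<? m | a ℕ.≤? toℕ (w p)
          ... | yes q<m | _ = inj₂ (q<m , a≤wq)
          ... | no _ | yes a≤wp = inj₁ (p<m , a≤wp)
          ... | no q≮m | no a≰wp = contradiction (p<m , ℕₚ.≮⇒≥ q≮m , ℕₚ.≰⇒> a≰wp , a≤wq) outside

  ≗? : ∀ (u v : OneLine n) → Dec (u ≗ v)
  ≗? u v = Finₚ.all? λ x → u x Finₚ.≟ v x

  swap-step : ∀ {i j} → i < j → u i < u j → BruhatStep u (swapPos u i j)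
  swap-step {u} {i} {j} i<j ui<uj =
    i , j , i<j , (λ _ → refl) , inv-increase i<j ui<uj (swapPos-isSwap u i j)

  -- inv is bounded, so every increasing process stops.
  fuel-exhausted : length (pairs n) ℕ.≤ inv u + 0 → BruhatStep u v → ⊥
  fuel-exhausted {u} {v} full (_ , _ , _ , _ , inv<) =
    ℕₚ.<-irrefl refl (ℕₚ.<-≤-trans inv< (ℕₚ.≤-trans (inv-bound v) (ℕₚ.≤-trans full (ℕₚ.≤-reflexive (ℕₚ.+-identityʳ (inv u))))))

  fuel-step : ∀ {k} → length (pairs n) ℕ.≤ inv u + suc k → BruhatStep u v → length (pairs n) ℕ.≤ inv v + k
  fuel-step {u} {v} {k} bound (_ , _ , _ , _ , inv<) =
    ℕₚ.≤-trans bound (ℕₚ.≤-trans (ℕₚ.≤-reflexive (ℕₚ.+-suc (inv u) k)) (ℕₚ.+-monoˡ-≤ k inv<))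

  rank⇒≼ : Bij w → Bij u → w ⊑ u → w ≼ u
  rank⇒≼ {w} {u} Bw Bu w⊑u = go (length (pairs n)) Bw w⊑u (ℕₚ.m≤n+m _ (inv w))
    where
    go : ∀ k {w} → Bij w → w ⊑ u → length (pairs n) ℕ.≤ inv w + k → w ≼ u
    go k {w} Bw w⊑u bound with ≗? w u
    ... | yes w≗u = ≼-refl w≗u
    ... | no w≢u with rank-step Bw Bu w⊑u w≢u
    ...   | p , q , p<q , wp<wq , v⊑u with k
    ...     | zero = ⊥-elim (fuel-exhausted bound (swap-step p<q wp<wq))
    ...     | suc k′ = ≼-step (swap-step p<q wp<wq)
      (go k′ (bij-swap Bw (swapPos-isSwap w p q)) v⊑u (fuel-step bound (swap-step p<q wp<wq)))

  -- A step is defined by its inversion count only. Were the pair descending, the reverse swap would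
  -- be the one to gain inversions.
  step-up : Bij u → ((i , j , _) : BruhatStep u v) → u i < u j × IsSwap u i j v
  step-up {u} {v} B (i , j , i<j , v≗ , inv<) = ui<uj , sw
    where
    sw : IsSwap u i j v
    sw = isSwap-≗ v≗ (swapPos-isSwap u i j)
    open IsSwap sw
    ui<uj : u i < u j
    ui<uj with Finₚ.<-cmp (u i) (u j)
    ... | tri< lt _ _ = lt
    ... | tri≈ _ eq _ = contradiction (cong toℕ (Bij.injective B eq)) (ℕₚ.<⇒≢ i<j)
    ... | tri> _ _ gt = contradiction
      (inv-increase i<j (subst₂ _<_ (sym at-i) (sym at-j) gt) (isSwap-reverse sw)) (ℕₚ.<-asym inv<)

  ≗-bij : u ≗ v → Bij u → Bij v
  ≗-bij e B = record
    { injective = λ {x} {y} p → injective (trans (e x) (trans p (sym (e y))))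
    ; pos = pos ; u-pos = λ a → trans (sym (e (pos a))) (u-pos a) }
    where open Bij B

  ≼-bij : u ≼ v → Bij u → Bij v
  ≼-bij (≼-refl e) B = ≗-bij e B
  ≼-bij (≼-step s r) B = ≼-bij r (bij-swap B (proj₂ (step-up B s)))

  ≼-respʳ : u ≼ v → v ≗ w → u ≼ w
  ≼-respʳ (≼-refl e) e′ = ≼-refl λ x → trans (e x) (e′ x)
  ≼-respʳ (≼-step s r) e′ = ≼-step s (≼-respʳ r e′)

  inv-cong : u ≗ v → inv u ≡ inv v
  inv-cong {u} {v} e = trans (inv-sum u) (trans (sum-cong-≗ λ x → sum-cong-≗ λ y →
    cong₂ (λ p q → ind ((x Finₚ.<? y) ×-dec (p Finₚ.<? q))) (e y) (e x)) (sym (inv-sum v)))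

  ≼-snoc : u ≼ v → BruhatStep v w → u ≼ w
  ≼-snoc (≼-refl e) (i , j , i<j , w≗ , inv<) = ≼-step (i , j , i<j , (λ x → trans (w≗ x) (sym (e _))) ,
    subst (ℕ._< _) (sym (inv-cong e)) inv<) (≼-refl λ _ → refl)
  ≼-snoc (≼-step s r) t = ≼-step s (≼-snoc r t)

  ≼-inv : u ≼ v → inv u ℕ.≤ inv v
  ≼-inv (≼-refl e) = ℕₚ.≤-reflexive (inv-cong e)
  ≼-inv (≼-step (_ , _ , _ , _ , inv<) r) = ℕₚ.≤-trans (ℕₚ.<⇒≤ inv<) (≼-inv r)

-- Permutations close to w₀

module _ {n : ℕ} where

  private variable u v : OneLine n

  Antitone : OneLine n → Set
  Antitone t = ∀ {x y} → x < y → t y < t x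

  opposite-antitone : Antitone opposite
  opposite-antitone {x} {y} x<y = subst₂ ℕ._<_ (sym (Finₚ.opposite-prop y)) (sym (Finₚ.opposite-prop x))
    (ℕₚ.∸-monoʳ-< (s≤s x<y) (Finₚ.toℕ<n y))

  -- Values drop by at least one per position: counting back to the first position bounds `t x` from
  -- above, counting on to the last one bounds it from below.
  antitone⇒opposite : ∀ {t} → Antitone t → t ≗ opposite
  antitone⇒opposite {t} anti x = Finₚ.toℕ-injective (trans
    (ℕₚ.≤-antisym upper′ lower′) (sym (Finₚ.opposite-prop x)))
    where
    upper : ∀ k {x} → toℕ x ≡ k → toℕ (t x) + suc k ℕ.≤ n
    upper zero {x} _ = subst (ℕ._≤ n) (ℕₚ.+-comm 1 (toℕ (t x))) (Finₚ.toℕ<n (t x))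
    upper (suc k) {x} x≡ = ℕₚ.≤-trans
      (subst (ℕ._≤ toℕ (t x′) + suc k) (sym (ℕₚ.+-suc (toℕ (t x)) (suc k))) (ℕₚ.+-monoˡ-≤ (suc k) (anti x′<x)))
      (upper k x′≡)
      where
      k<n : k ℕ.< n
      k<n = ℕₚ.<-trans (ℕₚ.≤-reflexive (sym x≡)) (Finₚ.toℕ<n x)
      x′ : Fin n
      x′ = fromℕ< k<n
      x′≡ : toℕ x′ ≡ k
      x′≡ = Finₚ.toℕ-fromℕ< k<n
      x′<x : x′ < x
      x′<x = ℕₚ.≤-reflexive (trans (cong suc x′≡) (sym x≡))
    lower : ∀ k {x} → suc (toℕ x) + k ≡ n → n ℕ.≤ toℕ (t x) + suc (toℕ x)
    lower zero {x} e = subst (ℕ._≤ toℕ (t x) + suc (toℕ x)) (trans (sym (ℕₚ.+-identityʳ _)) e) (ℕₚ.m≤n+m (suc (toℕ x)) (toℕ (t x)))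
    lower (suc k) {x} e = ℕₚ.≤-trans (lower k {x′} (trans (cong (λ z → suc z + k) x′≡) (trans (sym (ℕₚ.+-suc (suc (toℕ x)) k)) e)))
      (ℕₚ.≤-trans (ℕₚ.≤-reflexive (trans (cong (λ z → toℕ (t x′) + suc z) x′≡) (ℕₚ.+-suc (toℕ (t x′)) (suc (toℕ x)))))
        (ℕₚ.+-monoˡ-≤ (suc (toℕ x)) (anti x<x′)))
      where
      sx<n : suc (toℕ x) ℕ.< n
      sx<n = subst (suc (suc (toℕ x)) ℕ.≤_) (trans (sym (ℕₚ.+-suc (suc (toℕ x)) k)) e) (ℕₚ.m≤m+n (suc (suc (toℕ x))) k)
      x′ : Fin n
      x′ = fromℕ< sx<n
      x′≡ : toℕ x′ ≡ suc (toℕ x)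
      x′≡ = Finₚ.toℕ-fromℕ< sx<n
      x<x′ : x < x′
      x<x′ = ℕₚ.≤-reflexive (sym x′≡)
    upper′ : toℕ (t x) ℕ.≤ n ℕ.∸ suc (toℕ x)
    upper′ = ℕₚ.m+n≤o⇒m≤o∸n (toℕ (t x)) (upper (toℕ x) refl)
    lower′ : n ℕ.∸ suc (toℕ x) ℕ.≤ toℕ (t x)
    lower′ = ℕₚ.m≤n+o⇒m∸n≤o n (suc (toℕ x)) (subst (n ℕ.≤_) (ℕₚ.+-comm (toℕ (t x)) (suc (toℕ x)))
      (lower (n ℕ.∸ suc (toℕ x)) (ℕₚ.m+[n∸m]≡n (Finₚ.toℕ<n x))))

  opposite-bij : Bij {n} opposite
  opposite-bij = record
    { injective = λ {x} {y} e → trans (sym (Finₚ.opposite-involutive x)) (trans (cong opposite e) (Finₚ.opposite-involutive y))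
    ; pos = opposite ; u-pos = Finₚ.opposite-involutive }

  low? : ∀ (u : OneLine n) m a x → Dec (toℕ x ℕ.< m × toℕ (u x) ℕ.< a)
  low? u m a x = (toℕ x ℕ.<? m) ×-dec (toℕ (u x) ℕ.<? a)

  high? : ∀ (u : OneLine n) m a x → Dec (m ℕ.≤ toℕ x × a ℕ.≤ toℕ (u x))
  high? u m a x = (m ℕ.≤? toℕ x) ×-dec (a ℕ.≤? toℕ (u x))

  rk+low : ∀ u m a → rk u m a + sum (λ x → ind (low? u m a x)) ≡ sum {n} (λ x → ind (toℕ x ℕ.<? m))
  rk+low u m a = trans (sym (∑-distrib-+ (λ x → ind (inCorner? u m a x)) (λ x → ind (low? u m a x))))
    (sum-cong-≗ λ x → ℕₚ.≤-antisym
      (ind-disjoint (inCorner? u m a x) (low? u m a x) (toℕ x ℕ.<? m) proj₁ proj₁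
        (λ (_ , p) (_ , q) → ℕₚ.<-irrefl refl (ℕₚ.<-≤-trans q p)))
      (ind-cover (toℕ x ℕ.<? m) (inCorner? u m a x) (low? u m a x) (split x)))
    where
    split : ∀ x → toℕ x ℕ.< m → (toℕ x ℕ.< m × a ℕ.≤ toℕ (u x)) ⊎ (toℕ x ℕ.< m × toℕ (u x) ℕ.< a)
    split x x<m with a ℕ.≤? toℕ (u x)
    ... | yes p = inj₁ (x<m , p)
    ... | no ¬p = inj₂ (x<m , ℕₚ.≰⇒> ¬p)

  rk+high : ∀ u m a → rk u m a + sum (λ x → ind (high? u m a x)) ≡ rk u n a
  rk+high u m a = trans (sym (∑-distrib-+ (λ x → ind (inCorner? u m a x)) (λ x → ind (high? u m a x))))
    (sum-cong-≗ λ x → ℕₚ.≤-antisym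
      (ind-disjoint (inCorner? u m a x) (high? u m a x) (inCorner? u n a x)
        (λ (_ , q) → Finₚ.toℕ<n x , q) (λ (_ , q) → Finₚ.toℕ<n x , q)
        (λ (p , _) (q , _) → ℕₚ.<-irrefl refl (ℕₚ.<-≤-trans p q)))
      (ind-cover (inCorner? u n a x) (inCorner? u m a x) (high? u m a x) λ (_ , q) → split x q))
    where
    split : ∀ x → a ℕ.≤ toℕ (u x) → (toℕ x ℕ.< m × a ℕ.≤ toℕ (u x)) ⊎ (m ℕ.≤ toℕ x × a ℕ.≤ toℕ (u x))
    split x q with toℕ x ℕ.<? m
    ... | yes p = inj₁ (p , q)
    ... | no ¬p = inj₂ (ℕₚ.≮⇒≥ ¬p , q)

  complement-≤ : ∀ {a b c d} → a + b ≡ c + d → b ℕ.≤ d → c ℕ.≤ a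
  complement-≤ {a} {b} {c} {d} e b≤d = ℕₚ.+-cancelʳ-≤ b c a
    (ℕₚ.≤-trans (ℕₚ.+-monoʳ-≤ c b≤d) (ℕₚ.≤-reflexive (sym e)))

  low-≤⇒rk-≥ : ∀ m a → sum (λ x → ind (low? u m a x)) ℕ.≤ sum (λ x → ind (low? v m a x)) → rk v m a ℕ.≤ rk u m a
  low-≤⇒rk-≥ {u} {v} m a = complement-≤ (trans (rk+low u m a) (sym (rk+low v m a)))

  high-≤⇒rk-≥ : Bij u → Bij v → ∀ m a →
    sum (λ x → ind (high? u m a x)) ℕ.≤ sum (λ x → ind (high? v m a x)) → rk v m a ℕ.≤ rk u m a
  high-≤⇒rk-≥ {u} {v} Bu Bv m a = complement-≤
    (trans (rk+high u m a) (trans (rk-total-≡ Bu Bv a) (sym (rk+high v m a))))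

  -- A low dot other than i and a high dot other than j would form a forbidden
  -- non-inversion, so one of the two counts is at most 1, and then v has at least as many.
  almost-top : Bij v → Bij u → (i j : Fin n) →
    (∀ {x y} → x < y → u x < u y → (x ≡ i ⊎ y ≡ j) ×
      (∃ λ q → q Fin.≤ x × v q Fin.≤ u x) × (∃ λ r → y Fin.≤ r × u y Fin.≤ v r)) →
    v ⊑ u
  almost-top {v} {u} Bv Bu i j nonInv m a = result
    where
    noninversion : ∀ {x y} → toℕ x ℕ.< m × toℕ (u x) ℕ.< a → m ℕ.≤ toℕ y × a ℕ.≤ toℕ (u y) →
      (x ≡ i ⊎ y ≡ j) × (∃ λ q → q Fin.≤ x × v q Fin.≤ u x) × (∃ λ r → y Fin.≤ r × u y Fin.≤ v r)
    noninversion (p , q) (p′ , q′) = nonInv (ℕₚ.<-≤-trans p p′) (ℕₚ.<-≤-trans q q′)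
    result : rk v m a ℕ.≤ rk u m a
    result with Finₚ.any? (λ x → low? u m a x ×-dec ¬? (x Finₚ.≟ i))
              | Finₚ.any? (λ y → high? u m a y ×-dec ¬? (y Finₚ.≟ j))
    ... | yes (x , xl , x≢i) | yes (y , yh , y≢j) = ⊥-elim ([ x≢i , y≢j ]′ (proj₁ (noninversion xl yh)))
    ... | no onlyᵢ | _ with low? u m a i | Finₚ.any? (high? u m a)
    ...   | yes il | yes (y , yh) with proj₁ (proj₂ (noninversion il yh))
    ...     | q , q≤i , vq≤ui = low-≤⇒rk-≥ {u} {v} m a (sum-single i q
                (λ {k} k≢i → ind-no (low? u m a k) λ kl → onlyᵢ (k , kl , k≢i))
                (ind-mono (low? u m a i) (low? v m a q)
                  λ (i<m , ui<a) → ℕₚ.≤-<-trans q≤i i<m , ℕₚ.≤-<-trans vq≤ui ui<a))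
    result | no onlyᵢ | _ | yes il | no ¬high = high-≤⇒rk-≥ Bu Bv m a
      (sum-mono λ x → ind-mono (high? u m a x) (high? v m a x) λ xh → ⊥-elim (¬high (x , xh)))
    result | no onlyᵢ | _ | no ¬il | _ = low-≤⇒rk-≥ {u} {v} m a
      (sum-mono λ x → ind-mono (low? u m a x) (low? v m a x) λ xl → ⊥-elim (absurd xl (x Finₚ.≟ i)))
      where
      absurd : ∀ {x} → toℕ x ℕ.< m × toℕ (u x) ℕ.< a → Dec (x ≡ i) → ⊥
      absurd xl (yes refl) = ¬il xl
      absurd xl (no x≢i) = onlyᵢ (_ , xl , x≢i)
    result | yes (x , xl , _) | no onlyⱼ with high? u m a j
    ...   | yes jh with proj₂ (proj₂ (noninversion xl jh))
    ...     | r , j≤r , uj≤vr = high-≤⇒rk-≥ Bu Bv m a (sum-single j r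
                (λ {k} k≢j → ind-no (high? u m a k) λ kh → onlyⱼ (k , kh , k≢j))
                (ind-mono (high? u m a j) (high? v m a r)
                  λ (m≤j , a≤uj) → ℕₚ.≤-trans m≤j j≤r , ℕₚ.≤-trans a≤uj uj≤vr))
    result | yes _ | no onlyⱼ | no ¬jh = high-≤⇒rk-≥ Bu Bv m a
      (sum-mono λ x → ind-mono (high? u m a x) (high? v m a x) λ xh → ⊥-elim (absurd xh (x Finₚ.≟ j)))
      where
      absurd : ∀ {x} → m ℕ.≤ toℕ x × a ℕ.≤ toℕ (u x) → Dec (x ≡ j) → ⊥
      absurd xh (yes refl) = ¬jh xh
      absurd xh (no x≢j) = onlyⱼ (_ , xh , x≢j)

  -- At a given (m , a), `w₀` cannot have both a low and a high dot, since they would form an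
  -- ascent. If either kind is absent, its rank is as large as possible.
  ≼-top : Bij u → u ≼ w₀
  ≼-top {u} Bu = rank⇒≼ Bu opposite-bij below
    where
    below : u ⊑ w₀
    below m a with Finₚ.any? (low? w₀ m a)
    ... | no ¬low = low-≤⇒rk-≥ {w₀} {u} m a
      (sum-mono λ x → ind-mono (low? w₀ m a x) (low? u m a x) λ xl → ⊥-elim (¬low (x , xl)))
    ... | yes (x , x<m , w₀x<a) = high-≤⇒rk-≥ opposite-bij Bu m a
      (sum-mono λ y → ind-mono (high? w₀ m a y) (high? u m a y) λ (m≤y , a≤w₀y) →
        contradiction (opposite-antitone (ℕₚ.<-≤-trans x<m m≤y)) (ℕₚ.<-asym (ℕₚ.<-≤-trans w₀x<a a≤w₀y)))

  -- The ascent is in the left weak order.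
  climb : ∀ {Q : OneLine n → Set} →
    (∀ {u p q} → Bij u → Q u → p < q → toℕ (u q) ≡ suc (toℕ (u p)) → Q (swapPos u p q)) →
    Bij u → Q u → ∃ λ t → Q t × t ≗ w₀
  climb {u} {Q} step Bu Qu = go (length (pairs n)) Bu Qu (ℕₚ.m≤n+m _ (inv u))
    where
    up< : ∀ {u : OneLine n} {p q} → toℕ (u q) ≡ suc (toℕ (u p)) → u p < u q
    up< e = ℕₚ.≤-reflexive (sym e)
    go : ∀ k {u} → Bij u → Q u → length (pairs n) ℕ.≤ inv u + k → ∃ λ t → Q t × t ≗ w₀
    go k {u} Bu Qu bound
      with Finₚ.any? (λ p → Finₚ.any? λ q → (p Finₚ.<? q) ×-dec (toℕ (u q) ℕ.≟ suc (toℕ (u p))))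
    ... | yes (p , q , p<q , e) with k
    ...   | zero = ⊥-elim (fuel-exhausted bound (swap-step {u = u} p<q (up< {u} {p} {q} e)))
    ...   | suc k′ = go k′ (bij-swap Bu (swapPos-isSwap u p q)) (step Bu Qu p<q e)
                       (fuel-step bound (swap-step {u = u} p<q (up< {u} {p} {q} e)))
    go k {u} Bu Qu bound | no none = u , Qu , antitone⇒opposite anti
      where
      open Bij Bu
      anti : Antitone u
      anti {x} {y} x<y with Finₚ.<-cmp (u x) (u y)
      ... | tri> _ _ gt = gt
      ... | tri≈ _ eq _ = contradiction (cong toℕ (injective eq)) (ℕₚ.<⇒≢ x<y)
      -- Between the values of an ascent at `x < y` there are consecutive values whose positions
      -- pass from at most `x` to beyond `x`, so a further exchange would be available.
      ... | tri< lt _ _ with crossFin {P = λ a → x < pos a} (λ a → x Finₚ.<? pos a) lt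
                               (λ x<x → ℕₚ.<-irrefl refl (subst (x <_) (pos-u x) x<x))
                               (subst (x <_) (sym (pos-u y)) x<y)
      ...   | c , c′ , _ , c′≡ , _ , pc≤x , x<pc′ = ⊥-elim (none (pos c , pos c′ ,
                ℕₚ.≤-<-trans (ℕₚ.≮⇒≥ pc≤x) x<pc′ ,
                subst₂ (λ p q → toℕ p ≡ suc (toℕ q)) (sym (u-pos c′)) (sym (u-pos c)) c′≡))

-- The hull of a generator

perm-bij : ∀ {n} (g : Permutation′ n) → Bij (g ⟨$⟩ʳ_)
perm-bij g = record
  { injective = λ e → trans (sym (inverseˡ g)) (trans (cong (g ⟨$⟩ˡ_) e) (inverseˡ g))
  ; pos = g ⟨$⟩ˡ_ ; u-pos = λ _ → inverseʳ g }

suc⇒gap : ∀ {n} {c c′ : Fin n} → toℕ c′ ≡ suc (toℕ c) → c < c′ × (∀ {z : Fin n} → c < z → z < c′ → ⊥)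
suc⇒gap {c = c} {c′} e = ℕₚ.≤-reflexive (sym e) , λ {z} c<z z<c′ →
  ℕₚ.<-irrefl refl (ℕₚ.<-≤-trans z<c′ (subst (ℕ._≤ toℕ z) (sym e) c<z))

gap⇒suc : ∀ {n} {c c′ : Fin n} → c < c′ → (∀ {z : Fin n} → c < z → z < c′ → ⊥) → toℕ c′ ≡ suc (toℕ c)
gap⇒suc {n} {c} {c′} c<c′ gap = ℕₚ.≤-antisym (ℕₚ.≮⇒≥ λ sc<c′ →
  gap {fromℕ< (sc<n sc<c′)} (subst (toℕ c ℕ.<_) (sym (Finₚ.toℕ-fromℕ< (sc<n sc<c′))) ℕₚ.≤-refl)
    (subst (ℕ._< toℕ c′) (sym (Finₚ.toℕ-fromℕ< (sc<n sc<c′))) sc<c′)) c<c′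
  where
  sc<n : suc (toℕ c) ℕ.< toℕ c′ → suc (toℕ c) ℕ.< n
  sc<n p = ℕₚ.<-trans p (Finₚ.toℕ<n c′)

hessSetting : ∀ {n} (h : Hessenberg n) (g : Permutation′ n) → IsGenerator h g → Setting n
hessSetting {n} h g generator = record
  { _<_      = _<_
  ; sto      = Finₚ.<-isStrictTotalOrder
  ; cross    = crossing
  ; E        = λ i j → i < j × j Fin.≤ fun h i
  ; E?       = λ i j → (i Finₚ.<? j) ×-dec (j Finₚ.≤? fun h i)
  ; E⇒<      = proj₁
  ; E-shrink = λ {i} {j} {i′} {j′} (_ , j≤hi) i≤i′ i′<j′ j′≤j →
      i′<j′ , ℕₚ.≤-trans (ℕₚ.≮⇒≥ j′≤j) (ℕₚ.≤-trans j≤hi (monotone h {i} {i′} (ℕₚ.≮⇒≥ i≤i′)))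
  ; w        = g ⟨$⟩ʳ_
  ; pos      = g ⟨$⟩ˡ_
  ; w-pos    = λ _ → inverseʳ g
  ; pos-w    = λ _ → inverseˡ g
  ; gen      = λ {c} {c′} (c<c′ , gap) pc<pc′ → pc<pc′ , edge c c′ (gap⇒suc c<c′ gap)
  }
  where
  crossing : ∀ {P : Fin n → Set} → Decidable P → ∀ {a b} → a < b → ¬ P a → P b →
    ∃₂ λ c c′ → ¬ (c < a) × (c < c′ × (∀ {z : Fin n} → c < z → z < c′ → ⊥)) × ¬ (b < c′) × ¬ P c × P c′
  crossing P? a<b ¬Pa Pb with crossFin P? a<b ¬Pa Pb
  ... | c , c′ , a≤c , e , c′≤b , r = c , c′ , ℕₚ.≤⇒≯ a≤c , suc⇒gap e , ℕₚ.≤⇒≯ c′≤b , r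
  edge : ∀ c c′ → toℕ c′ ≡ suc (toℕ c) → (g ⟨$⟩ˡ c′) Fin.≤ fun h (g ⟨$⟩ˡ c)
  edge c c′ e = subst (λ z → (g ⟨$⟩ˡ z) Fin.≤ fun h (g ⟨$⟩ˡ c))
    (Finₚ.toℕ-injective (trans (Finₚ.toℕ-fromℕ< bound) wc+1)) (generator (g ⟨$⟩ˡ c) bound)
    where
    wc+1 : suc (toℕ (g ⟨$⟩ʳ (g ⟨$⟩ˡ c))) ≡ toℕ c′
    wc+1 = trans (cong (suc ∘ toℕ) (inverseʳ g)) (sym e)
    bound : suc (toℕ (g ⟨$⟩ʳ (g ⟨$⟩ˡ c))) ℕ.< n
    bound = subst (ℕ._< n) (sym wc+1) (Finₚ.toℕ<n c′)

module Generator {n : ℕ} (h : Hessenberg n) (g : Permutation′ n) (generator : IsGenerator h g) where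

  S : Setting n
  S = hessSetting h g generator

  open Theory S using (w; E; E?; E-shrink; Hi; Lo; Hi?; Lo?; Hi-mono; Lo-mono; InHull; StepEq;
    Avoid2143; Avoid1324)
  module Sᵒ = Theory (op S)
  open Splits S using (corner)

  private variable u v : OneLine n

  Bw : Bij w
  Bw = perm-bij g

  hull-w : InHull w
  hull-w p = (p , ℕₚ.<-irrefl refl , ℕₚ.<-irrefl refl) , (p , ℕₚ.<-irrefl refl , ℕₚ.<-irrefl refl)

  Good : OneLine n → Fin n → Fin n → Set
  Good u x y = E x y × Hi (u x) y × Lo (u y) x

  goodAt? : ∀ a x b y → Dec (E x y × Hi a y × Lo b x)
  goodAt? a x b y = E? x y ×-dec (Hi? a y ×-dec Lo? b x)

  Good? : ∀ u x y → Dec (Good u x y)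
  Good? u x y = goodAt? (u x) x (u y) y

  hi-≤ : ∀ {a b i j} → b Fin.≤ a → j Fin.≤ i → Hi a i → Hi b j
  hi-≤ b≤a j≤i = Hi-mono (ℕₚ.≤⇒≯ b≤a) (ℕₚ.≤⇒≯ j≤i)

  lo-≤ : ∀ {a b i j} → a Fin.≤ b → i Fin.≤ j → Lo a i → Lo b j
  lo-≤ a≤b i≤j = Lo-mono (ℕₚ.≤⇒≯ a≤b) (ℕₚ.≤⇒≯ i≤j)

  -- Only two of the four bounds need a hypothesis: `u j` moves left, which preserves `Hi`, and
  -- `u i` moves right, which preserves `Lo`. The other two are those in `Good`.
  hull-swap : ∀ {i j} → i < j → Hi (u i) j → Lo (u j) i → InHull u → IsSwap u i j v → InHull v
  hull-swap {u} {v} {i} {j} i<j hi lo hull (isSwap at-i at-j other) p = cases (p Finₚ.≟ i) (p Finₚ.≟ j)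
    where
    cases : Dec (p ≡ i) → Dec (p ≡ j) → Hi (v p) p × Lo (v p) p
    cases (yes refl) _ rewrite at-i = hi-≤ {u j} {u j} {j} {i} ℕₚ.≤-refl (ℕₚ.<⇒≤ i<j) (proj₁ (hull j)) , lo
    cases (no _) (yes refl) rewrite at-j = hi , lo-≤ {u i} {u i} {i} {j} ℕₚ.≤-refl (ℕₚ.<⇒≤ i<j) (proj₂ (hull i))
    cases (no p≢i) (no p≢j) rewrite other p≢i p≢j = hull p

  hull-up : ∀ {i j} → i < j → u i < u j → InHull u → IsSwap u i j v → InHull v
  hull-up {u} {v} {i} {j} i<j ui<uj hull = hull-swap i<j
    (hi-≤ {u j} {u i} {j} {j} (ℕₚ.<⇒≤ ui<uj) ℕₚ.≤-refl (proj₁ (hull j)))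
    (lo-≤ {u i} {u j} {i} {i} (ℕₚ.<⇒≤ ui<uj) ℕₚ.≤-refl (proj₂ (hull i))) hull

  hull-≗ : u ≗ v → InHull u → InHull v
  hull-≗ e hull p = subst (λ a → Hi a p × Lo a p) (e p) (hull p)

  hull-≼ : u ≼ v → Bij u → InHull u → InHull v
  hull-≼ (≼-refl e) _ hull = hull-≗ e hull
  hull-≼ {u} (≼-step s@(i , j , i<j , _) r) B hull =
    hull-≼ r (bij-swap B (proj₂ (step-up B s))) (hull-up {u} i<j (proj₁ (step-up B s)) hull (proj₂ (step-up B s)))

  ≼⇒hull : w ≼ u → InHull u
  ≼⇒hull r = hull-≼ r Bw hull-w

  -- A failure of the rank condition at (m , a) can be moved to a corner of the diagram
  -- of w, where the hull condition produces the two chains needed by `corner`.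
  hull⇒⊑ : Avoid2143 → Avoid1324 → Bij u → InHull u → w ⊑ u
  hull⇒⊑ {u} no2143 no1324 Bu hull m₀ a₀ = ℕₚ.≮⇒≥ start
    where
    open Bij Bw using (pos; u-pos; pos-u)
    V : ℕ → ℕ → Set
    V m a = rk u m a ℕ.< rk w m a
    V? : ∀ m a → Dec (V m a)
    V? m a = rk u m a ℕ.<? rk w m a

    ¬V-n : ∀ {a} → ¬ V n a
    ¬V-n {a} = ℕₚ.<-irrefl (rk-total-≡ Bu Bw a)

    -- Without a low dot of `u` at (p′ , a) its rank would be maximal; without a high dot the
    -- violation would persist at m = n. The hull turns one dot of each kind into the dots of `w`
    -- required by `corner`.
    finish : ∀ {p p′ a b} → toℕ p′ ≡ suc (toℕ p) → toℕ a ≡ suc (toℕ b) → V (toℕ p′) (toℕ a) →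
      a Fin.≤ w p → w p′ Fin.≤ b → pos a Fin.≤ p → p′ Fin.≤ pos b → ⊥
    finish {p} {p′} {a} {b} p′≡ a≡ viol a≤wp wp′≤b pa≤p p′≤pb
      with Finₚ.any? (low? u (toℕ p′) (toℕ a)) | Finₚ.any? (high? u (toℕ p′) (toℕ a))
    ... | no ¬low | _ = ℕₚ.<⇒≱ viol (rk-mono {u = w} {v = u} λ {x} x<p′ _ →
            x<p′ , ℕₚ.≮⇒≥ λ ux<a → ¬low (x , x<p′ , ux<a))
    ... | yes _ | no ¬high = ¬V-n {toℕ a} (ℕₚ.≤-<-trans
            (rk-mono {u = u} {v = u} λ {x} _ a≤ux → ℕₚ.≰⇒> (λ p′≤x → ¬high (x , p′≤x , a≤ux)) , a≤ux)
            (ℕₚ.<-≤-trans viol (rk-mono {u = w} {v = w} λ {x} _ a≤wx → Finₚ.toℕ<n x , a≤wx)))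
    ... | yes (x , x<p′ , ux<a) | yes (y , p′≤y , a≤uy) with proj₂ (hull x) | proj₁ (hull y)
    ...   | q , q≤x , wq≤ux | s , y≤s , uy≤ws =
      corner no2143 no1324 {p} {p′} {a} {b} {q} {s} (suc⇒gap p′≡) (proj₁ (suc⇒gap a≡))
        (ℕₚ.≤⇒≯ a≤wp) (ℕₚ.≤⇒≯ wp′≤b) (ℕₚ.≤⇒≯ pa≤p) (ℕₚ.≤⇒≯ p′≤pb)
        (ℕₚ.≤⇒≯ (ℕₚ.≤-trans (ℕₚ.≮⇒≥ q≤x) (ℕₚ.≤-pred (subst (toℕ x ℕ.<_) p′≡ x<p′))))
        (ℕₚ.≤⇒≯ (ℕₚ.≤-trans (ℕₚ.≮⇒≥ wq≤ux) (ℕₚ.≤-pred (subst (toℕ (u x) ℕ.<_) a≡ ux<a))))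
        (ℕₚ.≤⇒≯ (ℕₚ.≤-trans p′≤y (ℕₚ.≮⇒≥ y≤s)))
        (ℕₚ.≤⇒≯ (ℕₚ.≤-trans a≤uy (ℕₚ.≮⇒≥ uy≤ws)))

    -- As long as the next smaller value occurs in `w` at or before `p`, lowering `a` past it adds
    -- one to the rank of `w` and at most one to that of `u`, so the violation persists.
    lower : ∀ {p p′ y} → toℕ p′ ≡ suc (toℕ p) → V (toℕ p′) (toℕ y) →
      y Fin.≤ w p → w p′ < y → pos y Fin.≤ p → ⊥
    lower {p} {p′} {y} p′≡ viol y≤wp wp′<y py≤p
      with crossFin {P = λ a → V (toℕ p′) (toℕ a) × pos a Fin.≤ p}
             (λ a → V? (toℕ p′) (toℕ a) ×-dec (pos a Finₚ.≤? p)) wp′<y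
             (λ (_ , q) → ℕₚ.<-irrefl refl (subst (ℕ._≤ toℕ p) (trans (cong toℕ (pos-u p′)) p′≡) q))
             (viol , py≤p)
    ... | b , a , wp′≤b , a≡ , a≤y , ¬Pb , (Va , pa≤p) =
      finish {p} {p′} {a} {b} p′≡ a≡ Va (ℕₚ.≤-trans a≤y y≤wp) wp′≤b pa≤p
        (subst (ℕ._≤ toℕ (pos b)) (sym p′≡) (ℕₚ.≰⇒> λ pb≤p → ¬Pb (Vb pb≤p , pb≤p)))
      where
      m : ℕ
      m = toℕ p′
      Vb : pos b Fin.≤ p → V m (toℕ b)
      Vb pb≤p = begin-strict
        rk u m (toℕ b)                                      ≡⟨ rk-sucʳ Bu m b ⟩
        rk u m (suc (toℕ b)) + ind (toℕ (Bij.pos Bu b) ℕ.<? m) ≤⟨ ℕₚ.+-monoʳ-≤ _ (ind-mono (toℕ (Bij.pos Bu b) ℕ.<? m) (toℕ (pos b) ℕ.<? m) λ _ →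
                                                                 subst (toℕ (pos b) ℕ.<_) (sym p′≡) (s≤s pb≤p)) ⟩
        rk u m (suc (toℕ b)) + ind (toℕ (pos b) ℕ.<? m)     <⟨ ℕₚ.+-monoˡ-< _ (subst (V m) a≡ Va) ⟩
        rk w m (suc (toℕ b)) + ind (toℕ (pos b) ℕ.<? m)     ≡⟨ rk-sucʳ Bw m b ⟨
        rk w m (toℕ b)                                      ∎
        where open ℕₚ.≤-Reasoning

    -- `a` is raised until the violation or the bound by `w p` would fail at the next value. The
    -- value reached then occurs in `w` at or before `p`; otherwise the rank of `w` would not drop
    -- and one more step would be possible.
    raise : ∀ {p p′ a} → toℕ p′ ≡ suc (toℕ p) → V (toℕ p′) a → a ℕ.≤ toℕ (w p) → toℕ (w p′) ℕ.< a → ⊥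
    raise {p} {p′} {a} p′≡ viol a≤wp wp′<a
      with crossℕ {P = λ k → ¬ (k ℕ.≤ toℕ (w p) × V (toℕ p′) k)}
             (λ k → ¬? ((k ℕ.≤? toℕ (w p)) ×-dec V? (toℕ p′) k))
             (ℕₚ.m≤n⇒m≤1+n a≤wp) (λ ¬p → ¬p (a≤wp , viol)) (λ (q , _) → ℕₚ.<-irrefl refl q)
    ... | c , a≤c , c≤wp , ¬¬c , ¬suc-c
      with decidable-stable ((c ℕ.≤? toℕ (w p)) ×-dec V? (toℕ p′) c) ¬¬c
    ...   | _ , Vc = lower {p} {p′} {y} p′≡ (subst (V (toℕ p′)) (sym y≡) Vc)
        (subst (ℕ._≤ toℕ (w p)) (sym y≡) (ℕₚ.≤-pred c≤wp)) (subst (toℕ (w p′) ℕ.<_) (sym y≡) (ℕₚ.<-≤-trans wp′<a a≤c))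
        (ℕₚ.≮⇒≥ λ p<py → ¬suc-c (suc-c≤wp p<py , V-suc p<py))
      where
      c<n : c ℕ.< n
      c<n = ℕₚ.<-≤-trans c≤wp (Finₚ.toℕ<n (w p))
      y : Fin n
      y = fromℕ< c<n
      y≡ : toℕ y ≡ c
      y≡ = Finₚ.toℕ-fromℕ< c<n
      m : ℕ
      m = toℕ p′
      suc-c≤wp : p < pos y → suc c ℕ.≤ toℕ (w p)
      suc-c≤wp p<py = ℕₚ.≤∧≢⇒< (ℕₚ.≤-pred c≤wp) λ c≡wp →
        ℕₚ.<-irrefl (cong toℕ (trans (sym (pos-u p)) (cong pos (Finₚ.toℕ-injective (trans (sym c≡wp) (sym y≡)))))) p<py
      V-suc : p < pos y → V m (suc c)
      V-suc p<py = begin-strict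
        rk u m (suc c)                                       ≤⟨ rk-mono {u = u} {v = u} (λ p q → p , ℕₚ.<⇒≤ q) ⟩
        rk u m c                                             <⟨ Vc ⟩
        rk w m c                                             ≡⟨ cong (rk w m) y≡ ⟨
        rk w m (toℕ y)                                       ≡⟨ rk-sucʳ Bw m y ⟩
        rk w m (suc (toℕ y)) + ind (toℕ (pos y) ℕ.<? m)      ≡⟨ cong₂ (λ a b → rk w m (suc a) + b) y≡
             (ind-no (toℕ (pos y) ℕ.<? m) λ py<m → ℕₚ.<-irrefl refl (ℕₚ.<-≤-trans py<m (subst (ℕ._≤ toℕ (pos y)) (sym p′≡) p<py))) ⟩
        rk w m (suc c) + 0                                   ≡⟨ ℕₚ.+-identityʳ _ ⟩
        rk w m (suc c)                                       ∎
        where open ℕₚ.≤-Reasoning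

    -- A violation can begin only at a position where `w` reaches `a₀`, and it continues while `w`
    -- does. It ends before n, where the ranks agree, so some `p` with `w p` at least `a₀` is
    -- followed by `p′` with `w p′` below `a₀`.
    start : ¬ V m₀ a₀
    start viol with crossℕ {P = λ k → V k a₀} (λ k → V? k a₀) z≤n
        (λ v0 → ℕₚ.<⇒≱ v0 (rk-mono {u = w} {v = u} {m = 0} {m′ = 0} {a = a₀} {a′ = a₀} λ ())) viol
    ... | c , _ , _ , ¬Vc , Vsc with Finₚ.any? (λ x → (toℕ x ℕ.≟ c) ×-dec (a₀ ℕ.≤? toℕ (w x)))
    ...   | no none = ¬Vc (ℕₚ.≤-<-trans (rk-mono {u = u} {v = u} λ p q → ℕₚ.m≤n⇒m≤1+n p , q)
              (ℕₚ.<-≤-trans Vsc (rk-mono {u = w} {v = w} λ {x} p q →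
                ℕₚ.≤∧≢⇒< (ℕₚ.≤-pred p) (λ x≡c → none (x , x≡c , q)) , q)))
    ...   | yes (x₀ , x₀≡c , a₀≤wx₀)
      with crossℕ {P = λ k → ¬ R k} (λ k → ¬? (R? k)) (ℕₚ.<⇒≤ (Finₚ.toℕ<n x₀))
             (λ ¬r → ¬r (x₀ , refl , a₀≤wx₀ , subst (λ z → V (suc z) a₀) (sym x₀≡c) Vsc))
             (λ (x , x≡n , _) → ℕₚ.<⇒≢ (Finₚ.toℕ<n x) x≡n)
      where
      R : ℕ → Set
      R k = ∃ λ x → toℕ x ≡ k × a₀ ℕ.≤ toℕ (w x) × V (suc k) a₀
      R? : ∀ k → Dec (R k)
      R? k = Finₚ.any? λ x → (toℕ x ℕ.≟ k) ×-dec ((a₀ ℕ.≤? toℕ (w x)) ×-dec V? (suc k) a₀)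
    ...     | k , _ , k<n , ¬¬Rk , ¬Rsk with decidable-stable
        (Finₚ.any? λ x → (toℕ x ℕ.≟ k) ×-dec ((a₀ ℕ.≤? toℕ (w x)) ×-dec V? (suc k) a₀)) ¬¬Rk
    ...       | p , p≡k , a₀≤wp , Vsk =
      raise {p} {p′} (trans p′≡ (cong suc (sym p≡k))) (subst (λ z → V z a₀) (sym p′≡) Vsk) a₀≤wp
        (ℕₚ.≰⇒> λ a₀≤wp′ → ¬Rsk (p′ , p′≡ , a₀≤wp′ , V-suc a₀≤wp′))
      where
      sk<n : suc k ℕ.< n
      sk<n = ℕₚ.≤∧≢⇒< k<n λ sk≡n → ¬V-n {a₀} (subst (λ z → V z a₀) sk≡n Vsk)
      p′ : Fin n
      p′ = fromℕ< sk<n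
      p′≡ : toℕ p′ ≡ suc k
      p′≡ = Finₚ.toℕ-fromℕ< sk<n
      V-suc : a₀ ℕ.≤ toℕ (w p′) → V (suc (suc k)) a₀
      V-suc a₀≤wp′ = subst (λ z → V (suc z) a₀) p′≡ (begin-strict
        rk u (suc (toℕ p′)) a₀                                ≡⟨ rk-sucˡ u p′ a₀ ⟩
        rk u (toℕ p′) a₀ + ind (a₀ ℕ.≤? toℕ (u p′))           ≤⟨ ℕₚ.+-monoʳ-≤ _ (ind-mono (a₀ ℕ.≤? toℕ (u p′)) (a₀ ℕ.≤? toℕ (w p′)) λ _ → a₀≤wp′) ⟩
        rk u (toℕ p′) a₀ + ind (a₀ ℕ.≤? toℕ (w p′))           <⟨ ℕₚ.+-monoˡ-< _ (subst (λ z → V z a₀) (sym p′≡) Vsk) ⟩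
        rk w (toℕ p′) a₀ + ind (a₀ ℕ.≤? toℕ (w p′))           ≡⟨ rk-sucˡ w p′ a₀ ⟨
        rk w (suc (toℕ p′)) a₀                                ∎)
        where open ℕₚ.≤-Reasoning

  -- Hull edges under the exchange of consecutive values

  G : OneLine n → Fin n → Fin n → ℕ
  G u x y = ind (Good? u x y)

  good : OneLine n → ℕ
  good u = sum (λ x → sum (G u x))

  good-cong : u ≗ v → good u ≡ good v
  good-cong e = sum-cong-≗ λ x → sum-cong-≗ λ y → cong₂ (λ a b → ind (goodAt? a x b y)) (e x) (e y)

  module _ {u v : OneLine n} {p q : Fin n} (hull : InHull u) (p<q : p < q) (up+1 : toℕ (u q) ≡ suc (toℕ (u p)))
    (sw : IsSwap u p q v) where

    private
      open IsSwap sw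
      p≢q : p ≢ q
      p≢q refl = ℕₚ.<-irrefl refl p<q
      up<uq : u p < u q
      up<uq = ℕₚ.≤-reflexive (sym up+1)

      hi↓ : ∀ {y} → Hi (u q) y → Hi (u p) y
      hi↓ {y} = hi-≤ {u q} {u p} {y} {y} (ℕₚ.<⇒≤ up<uq) ℕₚ.≤-refl
      lo↑ : ∀ {x} → Lo (u p) x → Lo (u q) x
      lo↑ {x} = lo-≤ {u p} {u q} {x} {x} (ℕₚ.<⇒≤ up<uq) ℕₚ.≤-refl

      off : ∀ {x y} → x ≢ p → x ≢ q → y ≢ p → y ≢ q → G v x y ≡ G u x y
      off {x} {y} x≢p x≢q y≢p y≢q = cong₂ (λ a b → ind (goodAt? a x b y)) (other x≢p x≢q) (other y≢p y≢q)

      G-col-p : ∀ {x} → x ≢ p → x ≢ q → G v x p ≡ ind (goodAt? (u x) x (u q) p)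
      G-col-p {x} x≢p x≢q = cong₂ (λ a b → ind (goodAt? a x b p)) (other x≢p x≢q) at-i
      G-col-q : ∀ {x} → x ≢ p → x ≢ q → G v x q ≡ ind (goodAt? (u x) x (u p) q)
      G-col-q {x} x≢p x≢q = cong₂ (λ a b → ind (goodAt? a x b q)) (other x≢p x≢q) at-j
      G-row-p : ∀ {y} → y ≢ p → y ≢ q → G v p y ≡ ind (goodAt? (u q) p (u y) y)
      G-row-p {y} y≢p y≢q = cong₂ (λ a b → ind (goodAt? a p b y)) at-i (other y≢p y≢q)
      G-row-q : ∀ {y} → y ≢ p → y ≢ q → G v q y ≡ ind (goodAt? (u p) q (u y) y)
      G-row-q {y} y≢p y≢q = cong₂ (λ a b → ind (goodAt? a q b y)) at-j (other y≢p y≢q)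

      -- The rearrangement inequality. For `x < p`, the edge and `Hi` conditions are weaker at `p`
      -- than at `q`, and `Lo` is weaker for `u q` than for `u p`; the exchange combines the two
      -- weaker conditions. For `x` beyond `p`, `Lo (u p) x` is free by the hull condition at `p`.
      col : ∀ {x} → x ≢ p → x ≢ q → G u x p + G u x q ℕ.≤ G v x p + G v x q
      col {x} x≢p x≢q = subst (G u x p + G u x q ℕ.≤_) (sym (cong₂ _+_ (G-col-p x≢p x≢q) (G-col-q x≢p x≢q)))
        (ind-pair-mono (Good? u x p) (Good? u x q) (goodAt? (u x) x (u q) p) (goodAt? (u x) x (u p) q)
          (λ (e , hi , lo) → inj₁ (e , hi , lo↑ lo)) fromq
          (λ (e , hi , lo) (e′ , hi′ , lo′) → (e , hi , lo′) , (e′ , hi′ , lo)))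
        where
        fromq : Good u x q → (E x p × Hi (u x) p × Lo (u q) x) ⊎ (E x q × Hi (u x) q × Lo (u p) x)
        fromq (e , hi , lo) with Finₚ.<-cmp x p
        ... | tri< x<p _ _ = inj₁ (E-shrink {x} {q} {x} {p} e (ℕₚ.<-irrefl refl) x<p (ℕₚ.<-asym p<q) ,
                hi-≤ {u x} {u x} {q} {p} ℕₚ.≤-refl (ℕₚ.<⇒≤ p<q) hi , lo)
        ... | tri≈ _ x≡p _ = contradiction x≡p x≢p
        ... | tri> _ _ p<x = inj₂ (e , hi , lo-≤ {u p} {u p} {p} {x} ℕₚ.≤-refl (ℕₚ.<⇒≤ p<x) (proj₂ (hull p)))

      row : ∀ {y} → y ≢ p → y ≢ q → G u p y + G u q y ℕ.≤ G v p y + G v q y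
      row {y} y≢p y≢q = subst (G u p y + G u q y ℕ.≤_) (sym (cong₂ _+_ (G-row-p y≢p y≢q) (G-row-q y≢p y≢q)))
        (ind-pair-mono (Good? u p y) (Good? u q y) (goodAt? (u q) p (u y) y) (goodAt? (u p) q (u y) y)
          fromp (λ (e , hi , lo) → inj₂ (e , hi↓ hi , lo))
          (λ (e , hi , lo) (e′ , hi′ , lo′) → (e , hi′ , lo) , (e′ , hi , lo′)))
        where
        fromp : Good u p y → (E p y × Hi (u q) y × Lo (u y) p) ⊎ (E q y × Hi (u p) y × Lo (u y) q)
        fromp (e , hi , lo) with Finₚ.<-cmp y q
        ... | tri< y<q _ _ = inj₁ (e , hi-≤ {u q} {u q} {q} {y} ℕₚ.≤-refl (ℕₚ.<⇒≤ y<q) (proj₁ (hull q)) , lo)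
        ... | tri≈ _ y≡q _ = contradiction y≡q y≢q
        ... | tri> _ _ q<y = inj₂ (E-shrink {p} {y} {q} {y} e (ℕₚ.<-asym p<q) q<y (ℕₚ.<-irrefl refl) , hi ,
                lo-≤ {u y} {u y} {p} {q} ℕₚ.≤-refl (ℕₚ.<⇒≤ p<q) lo)

      blk : G u p p + G u q p + (G u p q + G u q q) ≡ G v p p + G v q p + (G v p q + G v q q)
      blk = cong₂ _+_
        (cong₂ _+_ (no-edge p p (ℕₚ.<-irrefl refl)) (no-edge q p (ℕₚ.<-asym p<q)))
        (cong₂ _+_ (ind-cong (Good? u p q) (Good? v p q)
            (λ (e , _) → e , subst (λ a → Hi a q) (sym at-i) (proj₁ (hull q)) , subst (λ a → Lo a p) (sym at-j) (proj₂ (hull p)))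
            (λ (e , _) → e , hi↓ (proj₁ (hull q)) , lo↑ (proj₂ (hull p))))
          (no-edge q q (ℕₚ.<-irrefl refl)))
        where
        no-edge : ∀ x y → ¬ (x < y) → G u x y ≡ G v x y
        no-edge x y x≮y = ind-cong (Good? u x y) (Good? v x y)
          (λ (e , _) → ⊥-elim (x≮y (proj₁ e))) (λ (e , _) → ⊥-elim (x≮y (proj₁ e)))

      dominated : PairDominated² p≢q (G u) (G v)
      dominated = record { off = λ a b c d → ℕₚ.≤-reflexive (sym (off a b c d)) ; col = col ; row = row ; blk = ℕₚ.≤-reflexive blk }

    good-mono : good u ℕ.≤ good v
    good-mono = PairDominated².sum²-≤ dominated

    -- After the exchange, `k` has a good edge to `p`. Equality demands a good edge from `k` to `p`
    -- or `q` before it, and `¬ Lo (u p) k` leaves only `q`.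
    good-tight-col : good u ≡ good v → ∀ {k} → k < p → Lo (u q) k → ¬ Lo (u p) k → E k p → Hi (u k) p →
      E k q × Hi (u k) q
    good-tight-col e {k} k<p lo ¬lo Ekp hi = [ (λ (_ , _ , lo′) → contradiction lo′ ¬lo) , (λ (a , b , _) → a , b) ]′
      (ind-pair-reflect (Good? u k p) (Good? u k q) (goodAt? (u k) k (u q) p) (goodAt? (u k) k (u p) q)
        (trans (PairDominated².col-tight dominated e k≢p k≢q) (cong₂ _+_ (G-col-p k≢p k≢q) (G-col-q k≢p k≢q)))
        (inj₁ (Ekp , hi , lo)))
      where
      k≢p : k ≢ p
      k≢p refl = ℕₚ.<-irrefl refl k<p
      k≢q : k ≢ q
      k≢q refl = ℕₚ.<-asym k<p p<q

    good-tight-row : good u ≡ good v → ∀ {k} → q < k → Hi (u p) k → ¬ Hi (u q) k → E q k → Lo (u k) q →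
      E p k × Lo (u k) p
    good-tight-row e {k} q<k hi ¬hi Eqk lo = [ (λ (a , _ , b) → a , b) , (λ (_ , hi′ , _) → contradiction hi′ ¬hi) ]′
      (ind-pair-reflect (Good? u p k) (Good? u q k) (goodAt? (u q) p (u k) k) (goodAt? (u p) q (u k) k)
        (trans (PairDominated².row-tight dominated e k≢p k≢q) (cong₂ _+_ (G-row-p k≢p k≢q) (G-row-q k≢p k≢q)))
        (inj₂ (Eqk , hi , lo)))
      where
      k≢p : k ≢ p
      k≢p refl = ℕₚ.<-asym q<k p<q
      k≢q : k ≢ q
      k≢q refl = ℕₚ.<-irrefl refl q<k

    -- `StepEq` and its mirror image supply the only cases in which the implications behind `col`
    -- and `row` do not reverse by themselves.
    good-const : StepEq u → Sᵒ.StepEq u → good u ≡ good v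
    good-const stepEq stepEqᵒ = ℕₚ.≤-antisym good-mono (PairDominated².sum²-≤ reverse)
      where
      reverse : PairDominated² p≢q (G v) (G u)
      reverse = record
        { off = λ a b c d → ℕₚ.≤-reflexive (off a b c d)
        ; col = λ {x} x≢p x≢q → subst (ℕ._≤ G u x p + G u x q) (sym (cong₂ _+_ (G-col-p x≢p x≢q) (G-col-q x≢p x≢q)))
            (ind-pair-mono (goodAt? (u x) x (u q) p) (goodAt? (u x) x (u p) q) (Good? u x p) (Good? u x q)
              (fromp x) (λ (e , hi , lo) → inj₂ (e , hi , lo↑ lo))
              (λ (e , hi , lo) (e′ , hi′ , lo′) → (e , hi , lo′) , (e′ , hi′ , lo)))
        ; row = λ {y} y≢p y≢q → subst (ℕ._≤ G u p y + G u q y) (sym (cong₂ _+_ (G-row-p y≢p y≢q) (G-row-q y≢p y≢q)))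
            (ind-pair-mono (goodAt? (u q) p (u y) y) (goodAt? (u p) q (u y) y) (Good? u p y) (Good? u q y)
              (λ (e , hi , lo) → inj₁ (e , hi↓ hi , lo)) (fromq y)
              (λ (e , hi , lo) (e′ , hi′ , lo′) → (e , hi′ , lo) , (e′ , hi , lo′)))
        ; blk = ℕₚ.≤-reflexive (sym blk)
        }
        where
        fromp : ∀ x → E x p × Hi (u x) p × Lo (u q) x → Good u x p ⊎ Good u x q
        fromp x (e , hi , lo) with Lo? (u p) x
        ... | yes lo′ = inj₁ (e , hi , lo′)
        ... | no ¬lo with stepEq {x} {p} {q} p<q (suc⇒gap up+1) (proj₁ e) lo ¬lo e hi
        ...   | e′ , hi′ = inj₂ (e′ , hi′ , lo)
        fromq : ∀ y → E q y × Hi (u p) y × Lo (u y) q → Good u p y ⊎ Good u q y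
        fromq y (e , hi , lo) with Hi? (u q) y
        ... | yes hi′ = inj₂ (e , hi′ , lo)
        ... | no ¬hi with stepEqᵒ {y} {q} {p} p<q (up<uq , λ a b → proj₂ (suc⇒gap up+1) b a) (proj₁ e) hi ¬hi e lo
        ...   | e′ , lo′ = inj₁ (e′ , hi , lo′)

-- Degrees

swap-unique : ∀ {n} {v x : OneLine n} {i j i′ j′} → (∀ {a b} → v a ≡ v b → a ≡ b) →
  i < j → i′ < j′ → IsSwap v i j x → IsSwap v i′ j′ x → i ≡ i′ × j ≡ j′
swap-unique {v = v} {x} {i} {j} {i′} {j′} inj i<j i′<j′ s s′ = cases (i Finₚ.≟ i′) (i Finₚ.≟ j′)
  where
  module s = IsSwap s
  module s′ = IsSwap s′
  cases : Dec (i ≡ i′) → Dec (i ≡ j′) → i ≡ i′ × j ≡ j′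
  cases (yes refl) _ = refl , inj (trans (sym s.at-i) s′.at-i)
  cases (no _) (yes refl) with inj (trans (sym s.at-i) s′.at-j)
  ... | refl = contradiction i<j (ℕₚ.<-asym i′<j′)
  cases (no i≢i′) (no i≢j′) = contradiction (cong toℕ (inj (trans (sym (s′.other i≢i′ i≢j′)) s.at-i))) (ℕₚ.<⇒≢ i<j)

map-distinct : ∀ {A B : Set} {P : A → Set} {_≈_ : B → B → Set} (f : A → B) →
  (∀ {a b} → P a → P b → f a ≈ f b → a ≡ b) → ∀ {xs} → Unique xs → All P xs →
  AllPairs (λ a b → ¬ (a ≈ b)) (map f xs)
map-distinct f inj [] [] = []
map-distinct f inj (x∉ ∷ distinct) (Px ∷ Pxs) =
  Allₚ.map⁺ (All.zipWith (λ (x≢y , Py) e → x≢y (inj Px Py e)) (x∉ , Pxs)) ∷ map-distinct f inj distinct Pxs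

module Degree {n : ℕ} (h : Hessenberg n) (w g : Permutation′ n) (generator : IsGenerator h g) where
  open Generator h g generator hiding (Bw)
  open Theory S using (E; Hi; Lo; InHull)

  private variable u v : OneLine n

  g′ : OneLine n
  g′ = g ⟨$⟩ʳ_

  Bg : Bij g′
  Bg = perm-bij g

  -- Multiplication acts on values and swaps act on positions, so `φ` commutes with `swapPos` by
  -- definition.
  φ : OneLine n → OneLine n
  φ u k = w ⟨$⟩ʳ (g ⟨$⟩ˡ u k)

  φ-injective : ∀ {a b} → w ⟨$⟩ʳ (g ⟨$⟩ˡ a) ≡ w ⟨$⟩ʳ (g ⟨$⟩ˡ b) → a ≡ b
  φ-injective e = trans (sym (inverseʳ g)) (trans (cong (g ⟨$⟩ʳ_) (Bij.injective (perm-bij w) e)) (inverseʳ g))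

  vertex : g′ ≼ u → VertexΓ w g (φ u)
  vertex {u} r = u , (r , ≼-top (≼-bij r Bg)) , λ _ → refl

  record IsNeighbour (u x : OneLine n) (e : Fin n × Fin n) : Set where
    constructor isNeighbour
    field
      edge   : E (proj₁ e) (proj₂ e)
      inside : g′ ≼ swapPos u (proj₁ e) (proj₂ e)
      image  : x ≗ φ (swapPos u (proj₁ e) (proj₂ e))

  neighbour⇒ : v ≗ φ u → ∀ {x} → VertexΓ w g x × Adjacent h v x → ∃ (IsNeighbour u x)
  neighbour⇒ {v} {u} v≗ ((u′ , (r , _) , x≗) , (i , j , i<j , j≤hi , x≗swap)) =
    (i , j) , isNeighbour (i<j , j≤hi)
      (≼-respʳ r λ k → φ-injective (trans (sym (x≗ k)) (trans (x≗swap k) (v≗ (transpose i j k)))))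
      λ k → trans (x≗swap k) (v≗ (transpose i j k))

  neighbour⇐ : v ≗ φ u → ∀ {x} → ∃ (IsNeighbour u x) → VertexΓ w g x × Adjacent h v x
  neighbour⇐ {v} {u} v≗ ((i , j) , isNeighbour (i<j , j≤hi) r x≗) =
    (swapPos u i j , (r , ≼-top (≼-bij r Bg)) , x≗) ,
    (i , j , i<j , j≤hi , λ k → trans (x≗ k) (sym (v≗ (transpose i j k))))

  neighbour-unique : Bij u → ∀ {x y e e′} → x ≗ y → IsNeighbour u x e → IsNeighbour u y e′ → e ≡ e′
  neighbour-unique {u} Bu {x} {y} {i , j} {i′ , j′} x≗y (isNeighbour (i<j , _) _ x≗) (isNeighbour (i′<j′ , _) _ y≗) =
    ×-≡,≡→≡ (swap-unique (Bij.injective Bu) i<j i′<j′ (swapPos-isSwap u i j)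
      (isSwap-≗ (λ k → φ-injective (trans (sym (x≗ k)) (trans (x≗y k) (y≗ k)))) (swapPos-isSwap u i′ j′)))

  module _ {P : Fin n × Fin n → Set} (P? : Decidable P) where

    -- `≼` comes with no decision procedure here, so a degree is compared with the number of pairs
    -- that satisfy a decidable `P`, from each side under the implication needed for it.
    degree-≤ : v ≗ φ u → (∀ {i j} → E i j → g′ ≼ swapPos u i j → P (i , j)) →
      ∀ {d} → HasDegree h w g v d → d ℕ.≤ length (filter P? (pairs n))
    degree-≤ {v} {u} v≗ sound {d} (L , len , distinct , complete) = subst (ℕ._≤ length (filter P? (pairs n))) len
      (length-≤ {_≈_ = _≗_} {_∼_ = λ x e → x ≗ φ (swapPos u (proj₁ e) (proj₂ e))}
        (λ p q k → trans (p k) (sym (q k))) distinct (All.tabulate covered))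
      where
      covered : ∀ {x} → x ∈ L → Any (λ e → x ≗ φ (swapPos u (proj₁ e) (proj₂ e))) (filter P? (pairs n))
      covered {x} x∈L with neighbour⇒ v≗ (Equivalence.from (complete x) (Any.map (λ { refl _ → refl }) x∈L))
      ... | (i , j) , isNeighbour edge r x≗ = Any.map (λ { refl → x≗ })
        (∈-filter⁺ P? (∈-cartesianProduct⁺ (∈-allFin i) (∈-allFin j)) (sound edge r))

    degree-≥ : v ≗ φ u → Bij u → (∀ {i j} → P (i , j) → E i j × g′ ≼ swapPos u i j) →
      ∀ {d} → HasDegree h w g v d → length (filter P? (pairs n)) ℕ.≤ d
    degree-≥ {v} {u} v≗ Bu sound {d} (L , len , _ , complete) = subst (length (filter P? (pairs n)) ℕ.≤_) len
      (length-≤ {_≈_ = _≡_} {_∼_ = λ e x → IsNeighbour u x e}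
        (neighbour-unique Bu (λ _ → refl)) (Uniqueₚ.filter⁺ P? pairs-unique) (All.map found (Allₚ.all-filter P? (pairs n))))
      where
      pairs-unique : Unique (pairs n)
      pairs-unique = Uniqueₚ.cartesianProduct⁺ (Uniqueₚ.allFin⁺ n) (Uniqueₚ.allFin⁺ n)
      found : ∀ {e} → P e → Any (λ x → IsNeighbour u x e) L
      found {i , j} p with sound p
      ... | edge , r = Any.map (isNeighbour edge r ∘ (λ e k → sym (e k)))
        (Equivalence.to (complete (φ (swapPos u i j))) (neighbour⇐ v≗ ((i , j) , isNeighbour edge r λ _ → refl)))

    degree-≡ : v ≗ φ u → Bij u → (∀ {i j} → E i j → g′ ≼ swapPos u i j → P (i , j)) →
      (∀ {i j} → P (i , j) → E i j × g′ ≼ swapPos u i j) →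
      HasDegree h w g v (length (filter P? (pairs n)))
    degree-≡ {v} {u} v≗ Bu complete sound = map f es , Listₚ.length-map f es ,
      map-distinct {P = P} {_≈_ = _≗_} f
        (λ p q e → neighbour-unique Bu e (neigh p) (neigh q))
        (Uniqueₚ.filter⁺ P? (Uniqueₚ.cartesianProduct⁺ (Uniqueₚ.allFin⁺ n) (Uniqueₚ.allFin⁺ n)))
        (Allₚ.all-filter P? (pairs n)) ,
      λ x → mk⇔ (to x) (from x)
      where
      es : List (Fin n × Fin n)
      es = filter P? (pairs n)
      f : Fin n × Fin n → OneLine n
      f (i , j) = φ (swapPos u i j)
      neigh : ∀ {e} → P e → IsNeighbour u (f e) e
      neigh p = isNeighbour (proj₁ (sound p)) (proj₂ (sound p)) λ _ → refl
      to : ∀ x → VertexΓ w g x × Adjacent h v x → Any (x ≗_) (map f es)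
      to x nb with neighbour⇒ v≗ nb
      ... | (i , j) , isNeighbour edge r x≗ = Anyₚ.map⁺ (Any.map (λ { refl → x≗ })
        (∈-filter⁺ P? (∈-cartesianProduct⁺ (∈-allFin i) (∈-allFin j)) (complete edge r)))
      from : ∀ x → Any (x ≗_) (map f es) → VertexΓ w g x × Adjacent h v x
      from x a with find (Anyₚ.map⁻ a)
      ... | (i , j) , e∈ , x≗ with sound (proj₂ (∈-filter⁻ P? {xs = pairs n} e∈))
      ...   | edge , r = neighbour⇐ v≗ ((i , j) , isNeighbour edge r x≗)

  goodPairs? : ∀ u → Decidable (λ ((i , j) : Fin n × Fin n) → Good u i j)
  goodPairs? u (i , j) = Good? u i j

  #good : ∀ u → length (filter (goodPairs? u) (pairs n)) ≡ good u
  #good u = length-filter-pairs (goodPairs? u)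

  inside⇒good : ∀ {i j} → E i j → g′ ≼ swapPos u i j → Good u i j
  inside⇒good {u} {i} {j} edge r = edge ,
    subst (λ a → Hi a j) at-j (proj₁ (≼⇒hull r j)) , subst (λ a → Lo a i) at-i (proj₂ (≼⇒hull r i))
    where open IsSwap (swapPos-isSwap u i j)

  ascent? : Decidable (λ ((i , j) : Fin n × Fin n) → E i j × g′ i < g′ j)
  ascent? (i , j) = Theory.E? S i j ×-dec (g′ i Finₚ.<? g′ j)

  -- Consequences of regularity

  module Regular (regular : IsRegularΓ h w g) where
    d : ℕ
    d = proj₁ regular

    degree : g′ ≼ u → HasDegree h w g (φ u) d
    degree r = proj₂ regular _ (vertex r)

    d≤good : g′ ≼ u → d ℕ.≤ good u
    d≤good {u} r = subst (d ℕ.≤_) (#good u)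
      (degree-≤ (goodPairs? u) {u = u} (λ _ → refl) (inside⇒good {u}) (degree r))

    -- Swapping `i` and `j` in `w₀` creates only ascents that start at `i` or end at `j`. For these,
    -- membership in the hull is all that `almost-top` asks for.
    good-w₀≤d : good w₀ ℕ.≤ d
    good-w₀≤d = subst (ℕ._≤ d) (#good w₀)
      (degree-≥ (goodPairs? w₀) (λ _ → refl) opposite-bij inside (degree top))
      where
      top : g′ ≼ w₀
      top = ≼-top Bg
      inside : ∀ {i j} → Good w₀ i j → E i j × g′ ≼ swapPos w₀ i j
      inside {i} {j} (edge , hi , lo) = edge , rank⇒≼ Bg Bt (almost-top Bg Bt i j λ {x} {y} x<y tx<ty →
          one-sided x<y tx<ty ,
          (let q , q≤x , wq≤ = proj₂ (hull x) in q , ℕₚ.≮⇒≥ q≤x , ℕₚ.≮⇒≥ wq≤) ,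
          (let r , y≤r , ≤wr = proj₁ (hull y) in r , ℕₚ.≮⇒≥ y≤r , ℕₚ.≮⇒≥ ≤wr))
        where
        i<j : i < j
        i<j = proj₁ edge
        t : OneLine n
        t = swapPos w₀ i j
        sw : IsSwap w₀ i j t
        sw = swapPos-isSwap w₀ i j
        open IsSwap sw
        Bt : Bij t
        Bt = bij-swap opposite-bij sw
        hull : InHull t
        hull = hull-swap i<j hi lo (≼⇒hull top) sw
        one-sided : ∀ {x y} → x < y → t x < t y → x ≡ i ⊎ y ≡ j
        one-sided {x} {y} x<y tx<ty = cases (x Finₚ.≟ i) (y Finₚ.≟ j) (x Finₚ.≟ j) (y Finₚ.≟ i)
          where
          clash : ∀ {a b} → a < b → t x ≡ w₀ a → t y ≡ w₀ b → ⊥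
          clash a<b ex ey = ℕₚ.<-asym (opposite-antitone a<b) (subst₂ _<_ ex ey tx<ty)
          cases : Dec (x ≡ i) → Dec (y ≡ j) → Dec (x ≡ j) → Dec (y ≡ i) → x ≡ i ⊎ y ≡ j
          cases (yes e) _ _ _ = inj₁ e
          cases _ (yes e) _ _ = inj₂ e
          cases (no x≢i) (no y≢j) (yes refl) (yes refl) = contradiction x<y (ℕₚ.<-asym i<j)
          cases (no x≢i) (no y≢j) (yes refl) (no y≢i) = ⊥-elim (clash (ℕₚ.<-trans i<j x<y) at-j (other y≢i y≢j))
          cases (no x≢i) (no y≢j) (no x≢j) (yes refl) = ⊥-elim (clash (ℕₚ.<-trans x<y i<j) (other x≢i x≢j) at-i)
          cases (no x≢i) (no y≢j) (no x≢j) (no y≢i) = ⊥-elim (clash x<y (other x≢i x≢j) (other y≢i y≢j))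

    up : ∀ {i j} → g′ ≼ u → i < j → u i < u j → g′ ≼ swapPos u i j
    up {u} r i<j ui<uj = ≼-snoc r (swap-step {u = u} i<j ui<uj)

    good≤d : g′ ≼ u → good u ℕ.≤ d
    good≤d {u} r with climb {Q = λ t → g′ ≼ t × good u ℕ.≤ good t} step (≼-bij r Bg) (r , ℕₚ.≤-refl)
      where
      step : ∀ {t p q} → Bij t → g′ ≼ t × good u ℕ.≤ good t → p < q → toℕ (t q) ≡ suc (toℕ (t p)) →
        g′ ≼ swapPos t p q × good u ℕ.≤ good (swapPos t p q)
      step {t} {p} {q} _ (s , le) p<q e = up s p<q (ℕₚ.≤-reflexive (sym e)) ,
        ℕₚ.≤-trans le (good-mono (≼⇒hull s) p<q e (swapPos-isSwap t p q))
    ... | t , (_ , le) , t≗w₀ = ℕₚ.≤-trans le (ℕₚ.≤-trans (ℕₚ.≤-reflexive (good-cong t≗w₀)) good-w₀≤d)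

    good≡d : g′ ≼ u → good u ≡ d
    good≡d r = ℕₚ.≤-antisym (good≤d r) (d≤good r)

    -- A descending swap of g loses inversions and so leaves the interval; hence d is at most the
    -- number of ascending edges. These are all good, and `good g′` is at most d, so the two sets of
    -- edges coincide.
    ascent : Theory.GoodAscends S
    ascent {x} {y} edge hi lo = proj₂ (ind-reflect (ascent? (x , y)) (Good? g′ x y)
      (sum-tight (pointwise x) (sum-tight (λ x → sum-mono (pointwise x)) sums x) y) (edge , hi , lo))
      where
      pointwise : ∀ x y → ind (ascent? (x , y)) ℕ.≤ ind (Good? g′ x y)
      pointwise x y = ind-mono (ascent? (x , y)) (Good? g′ x y) λ (edge , gx<gy) →
        edge , (y , ℕₚ.<-irrefl refl , ℕₚ.<-asym gx<gy) , (x , ℕₚ.<-irrefl refl , ℕₚ.<-asym gx<gy)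
      base : g′ ≼ g′
      base = ≼-refl λ _ → refl
      inside⇒ascent : ∀ {i j} → E i j → g′ ≼ swapPos g′ i j → E i j × g′ i < g′ j
      inside⇒ascent {i} {j} edge r = edge , gi<gj
        where
        open IsSwap (swapPos-isSwap g′ i j)
        gi<gj : g′ i < g′ j
        gi<gj with Finₚ.<-cmp (g′ i) (g′ j)
        ... | tri< lt _ _ = lt
        ... | tri≈ _ eq _ = contradiction (cong toℕ (Bij.injective Bg eq)) (ℕₚ.<⇒≢ (proj₁ edge))
        ... | tri> _ _ gt = contradiction (≼-inv r) (ℕₚ.<⇒≱ (inv-increase (proj₁ edge)
                (subst₂ _<_ (sym at-i) (sym at-j) gt) (isSwap-reverse (swapPos-isSwap g′ i j))))
      sums : sum (λ x → sum (λ y → ind (ascent? (x , y)))) ≡ sum (λ x → sum (G g′ x))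
      sums = ℕₚ.≤-antisym (sum-mono λ x → sum-mono (pointwise x))
        (ℕₚ.≤-trans (good≤d base) (subst (d ℕ.≤_) (length-filter-pairs ascent?)
          (degree-≤ ascent? {u = g′} (λ _ → refl) inside⇒ascent (degree base))))

    stepEq : g′ ≼ u → Theory.StepEq S u
    stepEq {u} r {k} {p} {q} p<q (up<uq , gap) k<p lo ¬lo e hi =
      good-tight-col (≼⇒hull r) p<q (gap⇒suc up<uq gap) (swapPos-isSwap u p q)
        (trans (good≡d r) (sym (good≡d (up r p<q up<uq)))) {k} k<p lo ¬lo e hi

    stepEqᵒ : g′ ≼ u → Theory.StepEq (op S) u
    stepEqᵒ {u} r {k} {q} {p} p<q (up<uq , gap) q<k hi ¬hi e lo =
      good-tight-row (≼⇒hull r) p<q (gap⇒suc up<uq λ a b → gap b a) (swapPos-isSwap u p q)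
        (trans (good≡d r) (sym (good≡d (up r p<q up<uq)))) {k} q<k hi ¬hi e lo

    swapUp : ∀ {u i j} → g′ ≼ u → i < j → u i < u j →
      ∃ λ v → g′ ≼ v × v i ≡ u j × v j ≡ u i × (∀ {k} → k ≢ i → k ≢ j → v k ≡ u k)
    swapUp {u} {i} {j} r i<j ui<uj = swapPos u i j , up r i<j ui<uj , at-i , at-j , other
      where open IsSwap (swapPos-isSwap u i j)

    swapUpᵒ : ∀ {u i j} → g′ ≼ u → j < i → u j < u i →
      ∃ λ v → g′ ≼ v × v i ≡ u j × v j ≡ u i × (∀ {k} → k ≢ i → k ≢ j → v k ≡ u k)
    swapUpᵒ {u} {i} {j} r j<i uj<ui = swapPos u j i , up r j<i uj<ui , at-j , at-i , flip other
      where open IsSwap (swapPos-isSwap u j i)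

    ascentᵒ : Theory.GoodAscends (op S)
    ascentᵒ {x} {y} e hi lo = ascent {y} {x} e lo hi

    module Q  = Equality S ascent
    module Qᵒ = Equality (op S) ascentᵒ

    base : g′ ≼ g′
    base = ≼-refl λ _ → refl

    rightSplit : Theory.LeftSplit (op S)
    rightSplit {i} {i′} {j} {k} = Q.rightSplit (g′ ≼_) base swapUp stepEq {i} {i′} {j} {k}

    leftSplit : Theory.LeftSplit S
    leftSplit {i} {i′} {j} {k} = Qᵒ.rightSplit (g′ ≼_) base swapUpᵒ stepEqᵒ {i} {i′} {j} {k}

    avoid2143 : Theory.Avoid2143 S
    avoid2143 {i} {j} {k} {l} = Q.avoid2143 (g′ ≼_) base swapUp stepEq {i} {j} {k} {l}

  -- Regularity from avoidance and the split conditions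

  module Avoiding (leftSplit : Theory.LeftSplit S) (rightSplit : Theory.LeftSplit (op S))
    (no2143 : Theory.Avoid2143 S) (no1324 : Theory.Avoid1324 S) where

    hull⇒≼ : Bij u → InHull u → g′ ≼ u
    hull⇒≼ Bu hull = rank⇒≼ Bg Bu (hull⇒⊑ no2143 no1324 Bu hull)

    good≡w₀ : Bij u → InHull u → good u ≡ good w₀
    good≡w₀ {u} Bu hull with climb {Q = λ t → InHull t × good u ≡ good t} step Bu (hull , refl)
      where
      stepEq : ∀ {t} → InHull t → Theory.StepEq S t
      stepEq {t} H {k} {p} {q} = Splits.stepEq S leftSplit rightSplit no2143 {t} H {k} {p} {q}
      stepEqᵒ : ∀ {t} → InHull t → Theory.StepEq (op S) t
      stepEqᵒ {t} H {k} {p} {q} = Splits.stepEq (op S) rightSplit leftSplit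
        (λ {i} {j} {k} {l} a b c e x y z → no2143 {l} {k} {j} {i} c b a e z y x) {t} (λ p → proj₂ (H p) , proj₁ (H p)) {k} {p} {q}
      step : ∀ {t p q} → Bij t → InHull t × good u ≡ good t → p < q → toℕ (t q) ≡ suc (toℕ (t p)) →
        InHull (swapPos t p q) × good u ≡ good (swapPos t p q)
      step {t} {p} {q} _ (H , eq) p<q e = hull-up {t} p<q (ℕₚ.≤-reflexive (sym e)) H (swapPos-isSwap t p q) ,
        trans eq (good-const H p<q e (swapPos-isSwap t p q) (stepEq H) (stepEqᵒ H))
    ... | t , (_ , eq) , t≗w₀ = trans eq (good-cong t≗w₀)

    regular : IsRegularΓ h w g
    regular = good w₀ , λ v (u , (r , _) , v≗) →
      let Bu = ≼-bij r Bg in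
      subst (HasDegree h w g v) (trans (#good u) (good≡w₀ Bu (≼⇒hull r)))
        (degree-≡ (goodPairs? u) v≗ Bu (inside⇒good {u}) (inside (≼⇒hull r) Bu))
      where
      inside : InHull u → Bij u → ∀ {i j} → Good u i j → E i j × g′ ≼ swapPos u i j
      inside {u} hull Bu {i} {j} (edge , hi , lo) = edge ,
        hull⇒≼ (bij-swap Bu (swapPos-isSwap u i j)) (hull-swap (proj₁ edge) hi lo hull (swapPos-isSwap u i j))

theorem4p14 : (n : ℕ) (h : Hessenberg n) (w w̃ : Permutation′ n) →
    IsCorrespondingGenerator h w w̃ →
    (IsRegularΓ h w w̃ ⇔ AvoidsAllPatterns h w)
theorem4p14 n h w w̃ (generator , agree) = mk⇔ avoids regular
  where
  open Degree h w w̃ generator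
  open Generator h w̃ generator using (S)
  open Theory S using (E)
  module D = Theory (op S)

  W : OneLine n
  W = w ⟨$⟩ʳ_

  -- The patterns only compare values at the two ends of an edge.
  lt : ∀ {i j} → E i j → W i < W j → g′ i < g′ j
  lt {i} {j} (i<j , j≤hi) = Equivalence.from (agree i j i<j j≤hi)

  lt⁻ : ∀ {i j} → E i j → g′ i < g′ j → W i < W j
  lt⁻ {i} {j} (i<j , j≤hi) = Equivalence.to (agree i j i<j j≤hi)

  gt : ∀ {i j} → E i j → W j < W i → g′ j < g′ i
  gt {i} {j} e Wj<Wi with Finₚ.<-cmp (g′ i) (g′ j)
  ... | tri< p _ _ = contradiction (lt⁻ {i} {j} e p) (ℕₚ.<-asym Wj<Wi)
  ... | tri≈ _ p _ = contradiction (cong toℕ (Bij.injective Bg p)) (ℕₚ.<⇒≢ (proj₁ e))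
  ... | tri> _ _ p = p

  gt⁻ : ∀ {i j} → E i j → g′ j < g′ i → W j < W i
  gt⁻ {i} {j} e gj<gi with Finₚ.<-cmp (W i) (W j)
  ... | tri< p _ _ = contradiction (lt {i} {j} e p) (ℕₚ.<-asym gj<gi)
  ... | tri≈ _ p _ = contradiction (cong toℕ (Bij.injective (perm-bij w) p)) (ℕₚ.<⇒≢ (proj₁ e))
  ... | tri> _ _ p = p

  ≰H : ∀ {i l : Fin n} → fun h i < l → ¬ E i l
  ≰H hi<l (_ , l≤hi) = ℕₚ.<⇒≱ hi<l l≤hi

  H< : ∀ {i l : Fin n} → i < l → ¬ E i l → fun h i < l
  H< i<l ¬e = ℕₚ.≰⇒> λ l≤hi → ¬e (i<l , l≤hi)

  sub : ∀ {i j k l} → E i l → i Fin.≤ j → j < k → k Fin.≤ l → E j k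
  sub {i} {j} {k} {l} e i≤j j<k k≤l = Theory.E-shrink S {i} {l} {j} {k} e (ℕₚ.≤⇒≯ i≤j) j<k (ℕₚ.≤⇒≯ k≤l)

  avoids : IsRegularΓ h w w̃ → AvoidsAllPatterns h w
  avoids reg = no2143 , no1324 , no1243 , no2134 , no1423 , no2314 ,
    (λ (i , j , k , l , m , P , a , b , c , d) → no5 i j k l m P (ℕₚ.<-trans a b) b (ℕₚ.<-trans c d) c) ,
    (λ (i , j , k , l , m , P , a , b , c , d) → no5 i j k l m P (ℕₚ.<-trans a b) b c (ℕₚ.<-trans c d)) ,
    (λ (i , j , k , l , m , P , a , b , c , d) → no5 i j k l m P b (ℕₚ.<-trans a b) c (ℕₚ.<-trans c d)) ,
    (λ (i , j , k , l , m , P , a , b , c , d) → no5 i j k l m P b (ℕₚ.<-trans a b) (ℕₚ.<-trans c d) c)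
    where
    open Regular reg
    no2143 : ¬ Contains2143 h w
    no2143 (i , j , k , l , i<j , j<k , k<l , l≤hi , a , b , c) =
      avoid2143 {i} {j} {k} {l} i<j j<k k<l Eil
        (gt {i} {j} (sub {i} {i} {j} {l} Eil ℕₚ.≤-refl i<j (ℕₚ.<⇒≤ (ℕₚ.<-trans j<k k<l))) a) (lt {i} {l} Eil b)
        (gt {k} {l} (sub {i} {k} {l} {l} Eil (ℕₚ.<⇒≤ (ℕₚ.<-trans i<j j<k)) k<l ℕₚ.≤-refl) c)
      where
      Eil : E i l
      Eil = ℕₚ.<-trans i<j (ℕₚ.<-trans j<k k<l) , l≤hi
    no1324 : ¬ Contains1324 h w
    no1324 (i , j , k , l , i<j , j<k , k<l , l≤hj , k≤hi , a , b , c) =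
      Q.avoid1324 {i} {j} {k} {l} i<j j<k k<l Ejl Eik (lt {i} {k} Eik a)
        (gt {j} {k} (sub {j} {j} {k} {l} Ejl ℕₚ.≤-refl j<k (ℕₚ.<⇒≤ k<l)) b) (lt {j} {l} Ejl c)
      where
      Ejl : E j l
      Ejl = ℕₚ.<-trans j<k k<l , l≤hj
      Eik : E i k
      Eik = ℕₚ.<-trans i<j j<k , k≤hi
    no1243 : ¬ Contains1243 h w
    no1243 (i , j , k , l , i<j , j<k , k<l , l≤hj , j≤hi , hi<l , a , b , c) =
      Q.avoid1243 leftSplit {i} {j} {k} {l} i<j j<k k<l Ejl (i<j , j≤hi) (≰H {i} {l} hi<l) (lt {i} {j} (i<j , j≤hi) a)
        (lt {j} {l} Ejl b) (gt {k} {l} (sub {j} {k} {l} {l} Ejl (ℕₚ.<⇒≤ j<k) k<l ℕₚ.≤-refl) c)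
      where
      Ejl : E j l
      Ejl = ℕₚ.<-trans j<k k<l , l≤hj
    no2134 : ¬ Contains2134 h w
    no2134 (i , j , k , l , i<j , j<k , k<l , l≤hk , k≤hi , hi<l , a , b , c) =
      Qᵒ.avoid1243 rightSplit {l} {k} {j} {i} k<l j<k i<j Eik (k<l , l≤hk) (≰H {i} {l} hi<l) (lt {k} {l} (k<l , l≤hk) c)
        (lt {i} {k} Eik b) (gt {i} {j} (sub {i} {i} {j} {k} Eik ℕₚ.≤-refl i<j (ℕₚ.<⇒≤ j<k)) a)
      where
      Eik : E i k
      Eik = ℕₚ.<-trans i<j j<k , k≤hi
    no1423 : ¬ Contains1423 h w
    no1423 (i , j , k , l , i<j , j<k , k<l , l≤hj , k≤hi , hi<l , a , b , c) =
      Q.avoid1423 leftSplit {i} {j} {k} {l} i<j j<k k<l Ejl Eik (≰H {i} {l} hi<l) (lt {i} {k} Eik a)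
        (lt {k} {l} (sub {j} {k} {l} {l} Ejl (ℕₚ.<⇒≤ j<k) k<l ℕₚ.≤-refl) b) (gt {j} {l} Ejl c)
      where
      Ejl : E j l
      Ejl = ℕₚ.<-trans j<k k<l , l≤hj
      Eik : E i k
      Eik = ℕₚ.<-trans i<j j<k , k≤hi
    no2314 : ¬ Contains2314 h w
    no2314 (i , j , k , l , i<j , j<k , k<l , l≤hj , k≤hi , hi<l , a , b , c) =
      Qᵒ.avoid1423 rightSplit {l} {k} {j} {i} k<l j<k i<j Eik Ejl (≰H {i} {l} hi<l) (lt {j} {l} Ejl c)
        (lt {i} {j} (sub {i} {i} {j} {k} Eik ℕₚ.≤-refl i<j (ℕₚ.<⇒≤ j<k)) b) (gt {i} {k} Eik a)
      where
      Ejl : E j l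
      Ejl = ℕₚ.<-trans j<k k<l , l≤hj
      Eik : E i k
      Eik = ℕₚ.<-trans i<j j<k , k≤hi
    no5 : ∀ i j k l m → Positions5 h w i j k l m → W l < W k → W i < W k → W k < W j → W k < W m → ⊥
    no5 i j k l m (i<j , j<k , k≤hi , hi<l , l≤hj , hj<m , m≤hk) a b c d =
      Q.avoid5 leftSplit {i} {j} {k} {l} {m} i<j j<k k<l l<m Eik (≰H {i} {l} hi<l) Ejl (≰H {j} {m} hj<m) Ekm
        (lt {i} {k} Eik b) (gt {k} {l} (sub {j} {k} {l} {l} Ejl (ℕₚ.<⇒≤ j<k) k<l ℕₚ.≤-refl) a)
        (gt {j} {k} (sub {j} {j} {k} {l} Ejl ℕₚ.≤-refl j<k (ℕₚ.<⇒≤ k<l)) c) (lt {k} {m} Ekm d)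
      where
      k<l : k < l
      k<l = ℕₚ.≤-<-trans k≤hi hi<l
      l<m : l < m
      l<m = ℕₚ.≤-<-trans l≤hj hj<m
      Eik : E i k
      Eik = ℕₚ.<-trans i<j j<k , k≤hi
      Ejl : E j l
      Ejl = ℕₚ.<-trans j<k k<l , l≤hj
      Ekm : E k m
      Ekm = ℕₚ.<-trans k<l l<m , m≤hk

  regular : AvoidsAllPatterns h w → IsRegularΓ h w w̃
  regular (no2143 , no1324 , no1243 , no2134 , no1423 , no2314 , no25314 , no24315 , no14325 , no15324) =
    Avoiding.regular
      (λ {i} {i′} {j} {k} → Theory.leftSplit S avoid1243 avoid1423 avoid5 {i} {i′} {j} {k})
      -- 2134 and 2314 are 1243 and 1423 in the reversed setting, and the common part of the
      -- patterns of length five is its own mirror image.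
      (λ {i} {i′} {j} {k} → D.leftSplit avoid2134 avoid2314
        (λ {i} {j} {k} {l} {m} i<j j<k k<l l<m Eik ¬Eil Ejl ¬Ejm Ekm a b c d →
          avoid5 {m} {l} {k} {j} {i} l<m k<l j<k i<j Ekm ¬Ejm Ejl ¬Eil Eik d c b a) {i} {i′} {j} {k})
      avoid2143 avoid1324
    where
    avoid2143 : Theory.Avoid2143 S
    avoid2143 {i} {j} {k} {l} i<j j<k k<l Eil a b c = no2143 (i , j , k , l , i<j , j<k , k<l , proj₂ Eil ,
      gt⁻ {i} {j} (sub {i} {i} {j} {l} Eil ℕₚ.≤-refl i<j (ℕₚ.<⇒≤ (ℕₚ.<-trans j<k k<l))) a , lt⁻ {i} {l} Eil b ,
      gt⁻ {k} {l} (sub {i} {k} {l} {l} Eil (ℕₚ.<⇒≤ (ℕₚ.<-trans i<j j<k)) k<l ℕₚ.≤-refl) c)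
    avoid1324 : Theory.Avoid1324 S
    avoid1324 {i} {j} {k} {l} i<j j<k k<l Ejl Eik a b c = no1324 (i , j , k , l , i<j , j<k , k<l , proj₂ Ejl , proj₂ Eik ,
      lt⁻ {i} {k} Eik a , gt⁻ {j} {k} (sub {j} {j} {k} {l} Ejl ℕₚ.≤-refl j<k (ℕₚ.<⇒≤ k<l)) b , lt⁻ {j} {l} Ejl c)
    avoid1243 : Theory.Avoid1243 S
    avoid1243 {i} {j} {k} {l} i<j j<k k<l Ejl Eij ¬Eil a b c = no1243 (i , j , k , l , i<j , j<k , k<l , proj₂ Ejl , proj₂ Eij ,
      H< {i} {l} (ℕₚ.<-trans i<j (ℕₚ.<-trans j<k k<l)) ¬Eil , lt⁻ {i} {j} Eij a , lt⁻ {j} {l} Ejl b ,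
      gt⁻ {k} {l} (sub {j} {k} {l} {l} Ejl (ℕₚ.<⇒≤ j<k) k<l ℕₚ.≤-refl) c)
    avoid2134 : D.Avoid1243
    avoid2134 {l} {k} {j} {i} k<l j<k i<j Eik Ekl ¬Eil c b a = no2134 (i , j , k , l , i<j , j<k , k<l , proj₂ Ekl , proj₂ Eik ,
      H< {i} {l} (ℕₚ.<-trans i<j (ℕₚ.<-trans j<k k<l)) ¬Eil ,
      gt⁻ {i} {j} (sub {i} {i} {j} {k} Eik ℕₚ.≤-refl i<j (ℕₚ.<⇒≤ j<k)) a , lt⁻ {i} {k} Eik b , lt⁻ {k} {l} Ekl c)
    avoid1423 : Theory.Avoid1423 S
    avoid1423 {i} {j} {k} {l} i<j j<k k<l Ejl Eik ¬Eil a b c = no1423 (i , j , k , l , i<j , j<k , k<l , proj₂ Ejl , proj₂ Eik ,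
      H< {i} {l} (ℕₚ.<-trans i<j (ℕₚ.<-trans j<k k<l)) ¬Eil , lt⁻ {i} {k} Eik a ,
      lt⁻ {k} {l} (sub {j} {k} {l} {l} Ejl (ℕₚ.<⇒≤ j<k) k<l ℕₚ.≤-refl) b , gt⁻ {j} {l} Ejl c)
    avoid2314 : D.Avoid1423
    avoid2314 {l} {k} {j} {i} k<l j<k i<j Eik Ejl ¬Eil c b a = no2314 (i , j , k , l , i<j , j<k , k<l , proj₂ Ejl , proj₂ Eik ,
      H< {i} {l} (ℕₚ.<-trans i<j (ℕₚ.<-trans j<k k<l)) ¬Eil , gt⁻ {i} {k} Eik a ,
      lt⁻ {i} {j} (sub {i} {i} {j} {k} Eik ℕₚ.≤-refl i<j (ℕₚ.<⇒≤ j<k)) b , lt⁻ {j} {l} Ejl c)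
    avoid5 : Theory.Avoid5 S
    avoid5 {i} {j} {k} {l} {m} i<j j<k k<l l<m Eik ¬Eil Ejl ¬Ejm Ekm a b c d =
      -- These two comparisons are across non-edges, so they are made in `W` and not carried over
      -- from g; each of the four outcomes is one of the patterns.
      cases (Finₚ.<-cmp (W i) (W l)) (Finₚ.<-cmp (W j) (W m))
      where
      P : Positions5 h w i j k l m
      P = i<j , j<k , proj₂ Eik , H< {i} {l} (ℕₚ.<-trans i<j (ℕₚ.<-trans j<k k<l)) ¬Eil , proj₂ Ejl ,
        H< {j} {m} (ℕₚ.<-trans j<k (ℕₚ.<-trans k<l l<m)) ¬Ejm , proj₂ Ekm
      ik : W i < W k
      ik = lt⁻ {i} {k} Eik a
      lk : W l < W k
      lk = gt⁻ {k} {l} (sub {j} {k} {l} {l} Ejl (ℕₚ.<⇒≤ j<k) k<l ℕₚ.≤-refl) b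
      kj : W k < W j
      kj = gt⁻ {j} {k} (sub {j} {j} {k} {l} Ejl ℕₚ.≤-refl j<k (ℕₚ.<⇒≤ k<l)) c
      km : W k < W m
      km = lt⁻ {k} {m} Ekm d
      W-inj : ∀ {x y} → x < y → W x ≢ W y
      W-inj x<y e = ℕₚ.<⇒≢ x<y (cong toℕ (Bij.injective (perm-bij w) e))
      cases : _ → _ → ⊥
      cases (tri≈ _ e _) _ = W-inj (ℕₚ.<-trans i<j (ℕₚ.<-trans j<k k<l)) e
      cases _ (tri≈ _ e _) = W-inj (ℕₚ.<-trans j<k (ℕₚ.<-trans k<l l<m)) e
      cases (tri< il _ _) (tri< jm _ _) = no14325 (i , j , k , l , m , P , il , lk , kj , jm)
      cases (tri< il _ _) (tri> _ _ mj) = no15324 (i , j , k , l , m , P , il , lk , km , mj)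
      cases (tri> _ _ li) (tri< jm _ _) = no24315 (i , j , k , l , m , P , li , ik , kj , jm)
      cases (tri> _ _ li) (tri> _ _ mj) = no25314 (i , j , k , l , m , P , li , ik , km , mj)
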